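{- The critical exponent of the infinite binary word $u=f(g(h^\omega(0)))$ is $2+\sqrt{2}/2$.
   Context: Morphisms: $f:\{0,1,2\}^*\to\{0,1\}^*$, $f(0)=0$, $f(1)=01$, $f(2)=011$; $g,h:\{0,1,2\}^*\to\{0,1,2\}^*$, $g(0)=011$, $g(1)=0121$, $g(2)=012121$, $h(0)=01$, $h(1)=02$, $h(2)=022$. $h^\omega(0)=\lim_n h^n(0)$ is the infinite fixed point of $h$ starting with $0$. A finite word $z=z_1\cdots z_m$ has period $p$ if $z_j=z_{j+p}$ for $1\le j\le m-p$, and then $m/p$ is an exponent of $z$. A word contains an $\alpha$-power if it has a nonempty factor with an exponent $\ge\alpha$; its critical exponent is the supremum of all rational $\alpha$ such that it contains an $\alpha$-power. -}

module Defs where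

open import Data.Nat using (ℕ; zero; suc; _+_; _*_; _∸_; _^_; _≤_; _<_)
open import Data.Fin using (Fin; zero; suc)
open import Data.List using (List; []; _∷_; concatMap)
open import Data.Product using (Σ; _×_; ∃-syntax)
open import Data.Sum using (_⊎_)
open import Relation.Binary.PropositionalEquality using (_≡_)

l0 l1 l2 : Fin 3
l0 = zero
l1 = suc zero
l2 = suc (suc zero)

b0 b1 : Fin 2
b0 = zero
b1 = suc zero

fL : Fin 3 → List (Fin 2)
fL zero = b0 ∷ []
fL (suc zero) = b0 ∷ b1 ∷ []
fL (suc (suc zero)) = b0 ∷ b1 ∷ b1 ∷ []

gL : Fin 3 → List (Fin 3)
gL zero = l0 ∷ l1 ∷ l1 ∷ []
gL (suc zero) = l0 ∷ l1 ∷ l2 ∷ l1 ∷ []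
gL (suc (suc zero)) = l0 ∷ l1 ∷ l2 ∷ l1 ∷ l2 ∷ l1 ∷ []

hL : Fin 3 → List (Fin 3)
hL zero = l0 ∷ l1 ∷ []
hL (suc zero) = l0 ∷ l2 ∷ []
hL (suc (suc zero)) = l0 ∷ l2 ∷ l2 ∷ []

f : List (Fin 3) → List (Fin 2)
f = concatMap fL

g : List (Fin 3) → List (Fin 3)
g = concatMap gL

h : List (Fin 3) → List (Fin 3)
h = concatMap hL

hIter : ℕ → List (Fin 3) → List (Fin 3)
hIter zero w = w
hIter (suc n) w = h (hIter n w)

nth : {A : Set} → A → List A → ℕ → A
nth d [] _ = d
nth d (x ∷ xs) zero = x
nth d (x ∷ xs) (suc i) = nth d xs i

-- h^(n)(0) has length ≥ 2^n ≥ n+1 and is a prefix of h^(n+1)(0), so the i-th letter of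
-- the fixed point h^ω(0) is the i-th letter of h^(i+1)(0); the default is never used.
hω : ℕ → Fin 3
hω i = nth l0 (hIter (suc i) (l0 ∷ [])) i

-- u = f(g(h^ω(0))); f(g(h^(i+1)(0))) is a prefix of u of length > i.
u : ℕ → Fin 2
u i = nth b0 (f (g (hIter (suc i) (l0 ∷ [])))) i

-- The infinite word w contains an (a/b)-power: there is a nonempty factor
-- z = w(i) ... w(i+m-1) (m ≥ 1) with a period p ≥ 1 (z_j = z_{j+p} whenever both
-- positions lie in z) such that m/p ≥ a/b, i.e. a * p ≤ m * b.
ContainsPower : {A : Set} → (ℕ → A) → ℕ → ℕ → Set
ContainsPower w a b =
  ∃[ i ] ∃[ m ] ∃[ p ]
    (1 ≤ m × 1 ≤ p ×
     (∀ j → j + p < m → w (i + j) ≡ w (i + j + p)) ×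
     a * p ≤ m * b)

-- Comparison of a nonnegative rational a/b (b ≥ 1) with the irrational number
-- 2 + √2/2, i.e. a/b < 2 + √2/2  ⇔  2a - 4b < √2·b, computed in ℕ.
-- (Equality never holds since 2 + √2/2 is irrational.)
BelowCrit : ℕ → ℕ → Set
BelowCrit a b = (2 * a ≤ 4 * b) ⊎ ((2 * a ∸ 4 * b) ^ 2 < 2 * b ^ 2)

AboveCrit : ℕ → ℕ → Set
AboveCrit a b = (4 * b < 2 * a) × (2 * b ^ 2 < (2 * a ∸ 4 * b) ^ 2)

{-# OPTIONS --safe #-}
module Submission where

-- Write v = h^ω(0). Counting the letter 2 as one 0 and one 1 turns the Parikh vector of a
-- word over {0,1,2} into a pair (x , y), read as x + y√2; then h acts as multiplication by
-- the unit 1 + √2, and |f(g(·))| = 5x + 8y. A repetition of period p and length p + a is an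
-- agreement of length a between two positions at distance p. The letter 0 marks the h-blocks,
-- so an agreement in v desubstitutes to an agreement of shorter period, up to a few
-- letters at its two ends. These end corrections depend only on whether the letters just
-- outside are {1,2}, and adding the fixed point of their recursion turns the length A into a
-- quantity B that is multiplied by 1 + √2 along with the period P, so B/P is invariant.
-- Descending to agreements of length at most one gives B ≤ (1 + √2/2) P with a fixed margin
-- unless P has norm ±1; this transfers to u because the 00's mark the blocks of f ∘ g.
-- Equality is attained along the orbit of P = 1 under (1 + √2)², which gives the lower bound.

-- Collapsing three letters to two weights is consistent because 2 behaves like 0 and 1 together:
-- h(2) = 022 has the weight of h(0)h(1), and |f(g(2))| = 13 = 5 + 8. The obstacle is that the
-- critical value is approached but not attained, so no rational estimate covers the tight orbit.
-- There the bound is kept as an exact pair of integers until the end: in `u` an extremal agreement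
-- falls one letter short of the corrected length 9x + 13y, and this single letter outweighs the
-- bounded defect 7(x² - 2y²) = ±7 between 2(4x + 5y)² and (5x + 8y)². All other cases, apart from
-- the period √2 itself, get by with the rational factor 5/3 < 1 + √2/2. Lengths are doubled because
-- the corrections that solve the recursion have halves as coordinates. Agreements in `u` of fewer
-- than 14 letters may miss every 00, so they are settled by a rational estimate and a finite check.

open import Defs
open import Data.Empty using (⊥)
open import Data.Fin using (Fin)
open import Data.Fin.Patterns using (0F; 1F; 2F)
import Data.Fin.Properties as Fin
open import Data.List using (List; []; _∷_; _++_; length; concatMap; drop)
open import Data.List.Properties using (length-++; concatMap-++; ++-assoc)
open import Data.Nat
open import Data.Nat.DivMod using (m<n*o⇒m/o<n)
open import Data.Nat.Properties
open import Data.Nat.Tactic.RingSolver using (solve-∀)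
open import Data.Product using (_×_; _,_; proj₁; proj₂; ∃-syntax)
open import Data.Sum using (_⊎_; inj₁; inj₂)
open import Data.Unit using (⊤; tt)
open import Relation.Nullary using (¬_; yes; no; contradiction; Dec)
open import Relation.Nullary.Decidable using (True; toWitness; ¬?; _×-dec_; _→-dec_)
open import Relation.Binary.PropositionalEquality

-- Certifies a linear inequality by a semiring identity with slack d.
linear : ∀ d {p q l r} → p ≤ q → r + p ≡ l + q + d → l ≤ r
linear d {p} {q} {l} {r} p≤q eq = +-cancelʳ-≤ q l r (begin
  l + q        ≤⟨ m≤m+n _ d ⟩
  l + q + d    ≡⟨ eq ⟨
  r + p        ≤⟨ +-monoʳ-≤ r p≤q ⟩
  r + q        ∎)
  where open ≤-Reasoning

≤⇒∃+ : ∀ {m n} → m ≤ n → ∃[ q ] n ≡ q + m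
≤⇒∃+ {m} {n} m≤n = n ∸ m , sym (m∸n+n≡m m≤n)

+-swap : ∀ a b c → a + (b + c) ≡ b + (a + c)
+-swap = solve-∀

-- Arithmetic in ℤ[√2]: periods of norm ±1 and the critical bound.

-- The norm x² − 2y² of x + y√2 is ±1.
NormOne : ℕ → ℕ → Set
NormOne x y = (x * x ≡ 1 + 2 * (y * y)) ⊎ (2 * (y * y) ≡ 1 + x * x)

norm⁺-step : ∀ x y → x * x ≡ 1 + 2 * (y * y) → 2 * ((x + y) * (x + y)) ≡ 1 + (x + 2 * y) * (x + 2 * y)
norm⁺-step x y eq = trans (lemma₁ x y) (trans (cong (_+ (x * x + 4 * (x * y) + 2 * (y * y))) eq) (lemma₂ x y))
  where
  lemma₁ : ∀ x y → 2 * ((x + y) * (x + y)) ≡ x * x + (x * x + 4 * (x * y) + 2 * (y * y))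
  lemma₁ = solve-∀
  lemma₂ : ∀ x y → 1 + 2 * (y * y) + (x * x + 4 * (x * y) + 2 * (y * y)) ≡ 1 + (x + 2 * y) * (x + 2 * y)
  lemma₂ = solve-∀

norm⁻-step : ∀ x y → 2 * (y * y) ≡ 1 + x * x → (x + 2 * y) * (x + 2 * y) ≡ 1 + 2 * ((x + y) * (x + y))
norm⁻-step x y eq = trans (lemma₁ x y) (trans (cong (_+ (x * x + 4 * (x * y) + 2 * (y * y))) eq) (lemma₂ x y))
  where
  lemma₁ : ∀ x y → (x + 2 * y) * (x + 2 * y) ≡ 2 * (y * y) + (x * x + 4 * (x * y) + 2 * (y * y))
  lemma₁ = solve-∀
  lemma₂ : ∀ x y → 1 + x * x + (x * x + 4 * (x * y) + 2 * (y * y)) ≡ 1 + 2 * ((x + y) * (x + y))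
  lemma₂ = solve-∀

NormOne-step : ∀ {x y} → NormOne x y → NormOne (x + 2 * y) (x + y)
NormOne-step {x} {y} (inj₁ eq) = inj₂ (norm⁺-step x y eq)
NormOne-step {x} {y} (inj₂ eq) = inj₁ (norm⁻-step x y eq)

-- 2β + γ√2 bounds twice the corrected agreement, x + y√2 is the period: in the tight case the
-- quotient is 2(1 + √2/2), in the slack case at most 10/3, and seed becomes slack after one step.
data Good : ℕ → ℕ → ℕ → ℕ → Set where
  tight : ∀ {x y} → NormOne x y → Good (x + y) (x + 2 * y) x y
  seed  : Good 1 1 0 1
  slack : ∀ {β γ x y} → 3 * β ≤ 5 * x → 3 * γ ≤ 10 * y → Good β γ x y

Good-step : ∀ {β γ x y} → Good β γ x y → Good (β + γ) (2 * β + γ) (x + 2 * y) (x + y)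
Good-step (tight {x} {y} norm) =
  subst₂ (λ β γ → Good β γ (x + 2 * y) (x + y)) (lemma₁ x y) (lemma₂ x y) (tight (NormOne-step {x} {y} norm))
  where
  lemma₁ : ∀ x y → x + 2 * y + (x + y) ≡ x + y + (x + 2 * y)
  lemma₁ = solve-∀
  lemma₂ : ∀ x y → x + 2 * y + 2 * (x + y) ≡ 2 * (x + y) + (x + 2 * y)
  lemma₂ = solve-∀
Good-step seed = slack (m≤m+n 6 4) (m≤m+n 9 1)
Good-step (slack {β} {γ} {x} {y} hβ hγ) =
  slack (linear 0 (+-mono-≤ hβ hγ) (lemma₁ β γ x y)) (linear 0 (+-mono-≤ (*-monoʳ-≤ 2 hβ) hγ) (lemma₂ β γ x y))
  where
  lemma₁ : ∀ β γ x y → 5 * (x + 2 * y) + (3 * β + 3 * γ) ≡ 3 * (β + γ) + (5 * x + 10 * y) + 0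
  lemma₁ = solve-∀
  lemma₂ : ∀ β γ x y → 10 * (x + y) + (2 * (3 * β) + 3 * γ) ≡ 3 * (2 * β + γ) + (2 * (5 * x) + 10 * y) + 0
  lemma₂ = solve-∀

-- The second hypothesis is 2(s - 1)² < p² with the subtraction cleared, and e ≤ s - 1.
2e²<s²⇒ : ∀ e s p → suc e ≤ s → 2 * (s * s) + 2 < p * p + 4 * s → 2 * (e * e) < p * p
2e²<s²⇒ e s p e< h with d , refl ← m≤n⇒∃[o]m+o≡n e< =
  linear (2 * (d * d) + 4 * (e * d)) h (lemma e d (p * p))
  where
  lemma : ∀ e d q → q + suc (2 * ((suc e + d) * (suc e + d)) + 2) ≡ suc (2 * (e * e)) + (q + 4 * (suc e + d)) + (2 * (d * d) + 4 * (e * d))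
  lemma = solve-∀

-- The difference of the two sides is governed by 2(4x + 5y)² − (5x + 8y)² = 7(x² − 2y²).
NormOne-margin : ∀ {x y} → NormOne x y →
  2 * ((4 * x + 5 * y) * (4 * x + 5 * y)) + 2 < (5 * x + 8 * y) * (5 * x + 8 * y) + 4 * (4 * x + 5 * y)
NormOne-margin {suc x} {y} (inj₁ eq) =
  linear (6 + 16 * x + 20 * y) (*-monoʳ-≤ 7 (≤-reflexive eq)) (lemma x y)
  where
  lemma : ∀ x y → (5 * suc x + 8 * y) * (5 * suc x + 8 * y) + 4 * (4 * suc x + 5 * y) + 7 * (suc x * suc x)
    ≡ suc (2 * ((4 * suc x + 5 * y) * (4 * suc x + 5 * y)) + 2) + 7 * (1 + 2 * (y * y)) + (6 + 16 * x + 20 * y)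
  lemma = solve-∀
NormOne-margin {x} {suc y} (inj₂ eq) =
  linear (24 + 16 * x + 20 * y) (*-monoʳ-≤ 7 (≤-reflexive (sym eq))) (lemma x y)
  where
  lemma : ∀ x y → (5 * x + 8 * suc y) * (5 * x + 8 * suc y) + 4 * (4 * x + 5 * suc y) + 7 * (1 + x * x)
    ≡ suc (2 * ((4 * x + 5 * suc y) * (4 * x + 5 * suc y)) + 2) + 7 * (2 * (suc y * suc y)) + (24 + 16 * x + 20 * y)
  lemma = solve-∀

-- Lengths in `u` are 5x + 8y; since `γ` is a doubled coordinate, this reads 5β + 4γ. In the tight
-- case it equals 9x + 13y, so taking off the period leaves e < 4x + 5y. The slack case gives 3e <
-- 2p, hence 8e² ≤ 9e² < 4p².
Good⇒subcritical : ∀ {β γ x y} → Good β γ x y → ∀ {a e} → suc a ≤ 5 * β + 4 * γ → 5 * x + 8 * y + e ≤ a →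
                   2 * (e * e) < (5 * x + 8 * y) * (5 * x + 8 * y)
Good⇒subcritical (tight {x} {y} norm) {a} {e} a< e≤ =
  2e²<s²⇒ e (4 * x + 5 * y) (5 * x + 8 * y) (linear 0 (+-mono-≤ a< e≤) (lemma x y a e)) (NormOne-margin {x} {y} norm)
  where
  lemma : ∀ x y a e → 4 * x + 5 * y + (suc a + (5 * x + 8 * y + e)) ≡ suc e + (5 * (x + y) + 4 * (x + 2 * y) + a) + 0
  lemma = solve-∀
Good⇒subcritical seed {a} {zero} a< e≤ = s≤s z≤n
Good⇒subcritical seed {a} {suc e} a< e≤ = contradiction {A = 1 ≤ 0} (linear e (+-mono-≤ a< e≤) (lemma a e)) λ ()
  where
  lemma : ∀ a e → 0 + (suc a + (8 + suc e)) ≡ 1 + (9 + a) + e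
  lemma = solve-∀
Good⇒subcritical (slack {β} {γ} {x} {y} hβ hγ) {a} {e} a< e≤ = 3e<2p⇒ e (5 * x + 8 * y) (linear 0
    (+-mono-≤ (+-mono-≤ (*-monoʳ-≤ 6 a<) (*-monoʳ-≤ 6 e≤)) (+-mono-≤ (*-monoʳ-≤ 10 hβ) (*-monoʳ-≤ 8 hγ))) (lemma β γ x y a e))
  where
  lemma : ∀ β γ x y a e → 2 * (2 * (5 * x + 8 * y)) + (6 * suc a + 6 * (5 * x + 8 * y + e) + (10 * (3 * β) + 8 * (3 * γ)))
    ≡ 2 * (suc (3 * e) + 2) + (6 * (5 * β + 4 * γ) + 6 * a + (10 * (5 * x) + 8 * (10 * y))) + 0
  lemma = solve-∀
  3e<2p⇒ : ∀ e p → 2 * (suc (3 * e) + 2) ≤ 2 * (2 * p) → 2 * (e * e) < p * p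
  3e<2p⇒ e p h = *-cancelˡ-< 4 _ _ (begin-strict
    4 * (2 * (e * e))                  ≤⟨ m≤m+n _ (e * e) ⟩
    4 * (2 * (e * e)) + e * e          ≡⟨ lemma′ e ⟩
    3 * e * (3 * e)                    <⟨ *-mono-< lt lt ⟩
    2 * p * (2 * p)                    ≡⟨ lemma″ p ⟩
    4 * (p * p)                        ∎)
    where
    open ≤-Reasoning
    lt : 3 * e < 2 * p
    lt = ≤-trans (m≤m+n _ 2) (*-cancelˡ-≤ 2 h)
    lemma′ : ∀ e → 4 * (2 * (e * e)) + e * e ≡ 3 * e * (3 * e)
    lemma′ = solve-∀
    lemma″ : ∀ p → 2 * p * (2 * p) ≡ 4 * (p * p)
    lemma″ = solve-∀

-- Approaching the critical ratio from below.

square-cancel-≤ : ∀ m n → m * m ≤ n * n → m ≤ n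
square-cancel-≤ m n h with m ≤? n
... | yes m≤n = m≤n
... | no  m≰n = contradiction h (<⇒≱ (*-mono-< (≰⇒> m≰n) (≰⇒> m≰n)))

-- With t = 5x + 8y and s = 8x + 10y one has s² = 2t² + 14, so s/t tends to √2.
ratio-approached : ∀ b q x y → q * q < 2 * (b * b) → 4 * (b * q) ≤ x → x * x ≡ 1 + 2 * (y * y) →
                   q * (5 * x + 8 * y) + 2 * b ≤ b * (8 * x + 10 * y)
ratio-approached b q x y q² x≥ norm = square-cancel-≤ _ _ (begin
  (q * t + 2 * b) * (q * t + 2 * b)                          ≡⟨ lemma₁ q t b ⟩
  -- The lower bound on `x` turns the cross term into one more t², which the strictness of q² < 2b²
  -- pays for.
  q * q * (t * t) + 4 * (b * q) * t + 4 * (b * b)            ≤⟨ +-monoˡ-≤ (4 * (b * b)) (+-monoʳ-≤ (q * q * (t * t)) (*-monoˡ-≤ t t≥)) ⟩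
  q * q * (t * t) + t * t + 4 * (b * b)                      ≡⟨ lemma₂ (q * q) (t * t) (4 * (b * b)) ⟩
  suc (q * q) * (t * t) + 4 * (b * b)                        ≤⟨ +-mono-≤ (*-monoˡ-≤ (t * t) q²) (*-monoˡ-≤ (b * b) (m≤m+n 4 10)) ⟩
  2 * (b * b) * (t * t) + 14 * (b * b)                       ≡⟨ lemma₃ (b * b) (t * t) ⟩
  b * b * (2 * (t * t) + 14 * 1)                             ≡⟨ cong (b * b *_) s² ⟨
  b * b * (s * s)                                            ≡⟨ lemma₄ b s ⟩
  b * s * (b * s)                                            ∎)
  where
  open ≤-Reasoning
  t = 5 * x + 8 * y
  s = 8 * x + 10 * y
  t≥ : 4 * (b * q) ≤ t
  t≥ = ≤-trans x≥ (≤-trans (m≤n*m x 5) (m≤m+n (5 * x) (8 * y)))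
  s² : s * s ≡ 2 * (t * t) + 14 * 1
  s² = +-cancelʳ-≡ (14 * (2 * (y * y))) _ _ (trans (lemma x y) (trans (cong (λ n → 2 * (t * t) + 14 * n) norm) (lemma′ (2 * (t * t)) (2 * (y * y)))))
    where
    lemma : ∀ x y → (8 * x + 10 * y) * (8 * x + 10 * y) + 14 * (2 * (y * y)) ≡ 2 * ((5 * x + 8 * y) * (5 * x + 8 * y)) + 14 * (x * x)
    lemma = solve-∀
    lemma′ : ∀ a b → a + 14 * (1 + b) ≡ a + 14 * 1 + 14 * b
    lemma′ = solve-∀
  lemma₁ : ∀ q t b → (q * t + 2 * b) * (q * t + 2 * b) ≡ q * q * (t * t) + 4 * (b * q) * t + 4 * (b * b)
  lemma₁ = solve-∀
  lemma₂ : ∀ a b c → a * b + b + c ≡ suc a * b + c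
  lemma₂ = solve-∀
  lemma₃ : ∀ a b → 2 * a * b + 14 * a ≡ a * (2 * b + 14 * 1)
  lemma₃ = solve-∀
  lemma₄ : ∀ b s → b * b * (s * s) ≡ b * s * (b * s)
  lemma₄ = solve-∀

-- Here `t` is a period and `c` an agreement one letter short of t + s/2; the summand 2b in the
-- second hypothesis pays for that letter.
power-ratio : ∀ a b q t s c → 2 * a ≤ 4 * b + q → q * t + 2 * b ≤ b * s → 2 * (c + 1) ≡ 2 * t + s → a * t ≤ (t + c) * b
power-ratio a b q t s c a≤ qt≤ c≡ = *-cancelˡ-≤ {a * t} {(t + c) * b} 2
  (linear 0 (+-mono-≤ (+-mono-≤ (*-monoˡ-≤ t a≤) qt≤) (*-monoʳ-≤ b (≤-reflexive (sym c≡)))) (lemma a b q t s c))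
  where
  lemma : ∀ a b q t s c → 2 * ((t + c) * b) + (2 * a * t + (q * t + 2 * b) + b * (2 * t + s))
    ≡ 2 * (a * t) + ((4 * b + q) * t + b * s + b * (2 * (c + 1))) + 0
  lemma = solve-∀

-- Images of infinite words under morphisms

nth-++ˡ : {A : Set} (z : A) (xs ys : List A) {n : ℕ} → n < length xs → nth z (xs ++ ys) n ≡ nth z xs n
nth-++ˡ z (x ∷ xs) ys {zero}  _         = refl
nth-++ˡ z (x ∷ xs) ys {suc n} (s≤s n<) = nth-++ˡ z xs ys n<

nth-++ʳ : {A : Set} (z : A) (xs ys : List A) (n : ℕ) → nth z (xs ++ ys) (n + length xs) ≡ nth z ys n
nth-++ʳ z []       ys n = cong (nth z ys) (+-identityʳ n)
nth-++ʳ z (x ∷ xs) ys n = trans (cong (nth z (x ∷ xs ++ ys)) (+-suc n (length xs))) (nth-++ʳ z xs ys n)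

offset : {A : Set} → (Fin 3 → List A) → (ℕ → Fin 3) → ℕ → ℕ
offset φ s zero    = 0
offset φ s (suc k) = length (φ (s k)) + offset φ s k

-- Describing the image block by block keeps the finite iterates out of the descent. The default `z`
-- is never read, since `d` lies inside the block.
IsImage : {A : Set} → (Fin 3 → List A) → A → (ℕ → Fin 3) → (ℕ → A) → Set
IsImage φ z s w = ∀ k d → d < length (φ (s k)) → w (d + offset φ s k) ≡ nth z (φ (s k)) d

fg : Fin 3 → List (Fin 2)
fg x = f (gL x)

fg-concatMap : ∀ xs → f (g xs) ≡ concatMap fg xs
fg-concatMap []       = refl
fg-concatMap (x ∷ xs) = trans (concatMap-++ fL (gL x) (g xs)) (cong (fg x ++_) (fg-concatMap xs))

hL-long : ∀ x → 2 ≤ length (hL x)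
hL-long 0F = s≤s (s≤s z≤n)
hL-long 1F = s≤s (s≤s z≤n)
hL-long 2F = s≤s (s≤s z≤n)

fg-long : ∀ x → 2 ≤ length (fg x)
fg-long 0F = s≤s (s≤s z≤n)
fg-long 1F = s≤s (s≤s z≤n)
fg-long 2F = s≤s (s≤s z≤n)

module _ {A : Set} (φ : Fin 3 → List A) (φ-long : ∀ x → 2 ≤ length (φ x)) where

  concatMap-long : ∀ xs → 2 * length xs ≤ length (concatMap φ xs)
  concatMap-long []       = z≤n
  concatMap-long (x ∷ xs) = begin
    2 * length (x ∷ xs)                    ≡⟨ *-suc 2 (length xs) ⟩
    2 + 2 * length xs                      ≤⟨ +-mono-≤ (φ-long x) (concatMap-long xs) ⟩
    length (φ x) + length (concatMap φ xs) ≡⟨ length-++ (φ x) ⟨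
    length (concatMap φ (x ∷ xs))          ∎
    where open ≤-Reasoning

  offset-grows : ∀ s q k → 2 * q + offset φ s k ≤ offset φ s (q + k)
  offset-grows s zero    k = ≤-refl
  offset-grows s (suc q) k = begin
    2 * suc q + offset φ s k                      ≡⟨ cong (_+ offset φ s k) (*-suc 2 q) ⟩
    2 + (2 * q + offset φ s k)                    ≤⟨ +-mono-≤ (φ-long (s (q + k))) (offset-grows s q k) ⟩
    length (φ (s (q + k))) + offset φ s (q + k)   ∎
    where open ≤-Reasoning

prefix : ℕ → List (Fin 3)
prefix n = hIter n (l0 ∷ [])

prefix-extends : ∀ n → ∃[ r ] prefix (suc n) ≡ prefix n ++ r
prefix-extends zero    = l1 ∷ [] , refl
prefix-extends (suc n) with r , eq ← prefix-extends n =
  h r , trans (cong h eq) (concatMap-++ hL (prefix n) r)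

prefix-long : ∀ n → n < length (prefix n)
prefix-long zero    = s≤s z≤n
prefix-long (suc n) = begin
  2 + n                       ≤⟨ +-mono-≤ (s≤s (z≤n {n})) (prefix-long n) ⟩
  suc n + length (prefix n)   ≤⟨ +-monoˡ-≤ _ (prefix-long n) ⟩
  length (prefix n) + length (prefix n) ≡⟨ cong (length (prefix n) +_) (+-identityʳ _) ⟨
  2 * length (prefix n)       ≤⟨ concatMap-long hL hL-long (prefix n) ⟩
  length (prefix (suc n))     ∎
  where open ≤-Reasoning

module Limit {A : Set} (z : A) (ws : ℕ → List A)
             (extends : ∀ n → ∃[ r ] ws (suc n) ≡ ws n ++ r)
             (long : ∀ n → n < length (ws n)) where

  nth-stable : ∀ m n i → i < length (ws n) → nth z (ws (m + n)) i ≡ nth z (ws n) i × i < length (ws (m + n))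
  nth-stable zero    n i i< = refl , i<
  nth-stable (suc m) n i i<
    with eq , i<m ← nth-stable m n i i< | r , ext ← extends (m + n) rewrite ext =
    trans (nth-++ˡ z (ws (m + n)) r i<m) eq ,
    ≤-trans i<m (≤-trans (m≤m+n _ _) (≤-reflexive (sym (length-++ (ws (m + n))))))

  -- Both sides are compared with `ws (n + suc i)`, which extends both lists.
  nth-limit : ∀ n i → i < length (ws n) → nth z (ws (suc i)) i ≡ nth z (ws n) i
  nth-limit n i i< = begin
    nth z (ws (suc i)) i        ≡⟨ proj₁ (nth-stable n (suc i) i (<⇒≤ (long (suc i)))) ⟨
    nth z (ws (n + suc i)) i    ≡⟨ cong (λ m → nth z (ws m) i) (+-comm n (suc i)) ⟩
    nth z (ws (suc i + n)) i    ≡⟨ proj₁ (nth-stable (suc i) n i i<) ⟩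
    nth z (ws n) i              ∎
    where open ≡-Reasoning

drop-nth : ∀ {A : Set} (z : A) xs {k} → k < length xs → drop k xs ≡ nth z xs k ∷ drop (suc k) xs
drop-nth z (x ∷ xs) {zero}  _        = refl
drop-nth z (x ∷ xs) {suc k} (s≤s k<) = drop-nth z xs k<

module _ {A : Set} (φ : Fin 3 → List A) (s : ℕ → Fin 3) (xs : List (Fin 3))
         (agrees : ∀ k → k < length xs → s k ≡ nth l0 xs k) where

  concatMap-split : ∀ k → k ≤ length xs →
    ∃[ pre ] (concatMap φ xs ≡ pre ++ concatMap φ (drop k xs) × length pre ≡ offset φ s k)
  concatMap-split zero    _  = [] , refl , refl
  concatMap-split (suc k) k< with pre , eq , len ← concatMap-split k (<⇒≤ k<) =
    pre ++ φ (s k) ,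
    (begin
      concatMap φ xs                                             ≡⟨ eq ⟩
      pre ++ concatMap φ (drop k xs)                             ≡⟨ cong (λ ys → pre ++ concatMap φ ys) (drop-nth l0 xs k<) ⟩
      pre ++ φ (nth l0 xs k) ++ concatMap φ (drop (suc k) xs)    ≡⟨ cong (λ x → pre ++ φ x ++ _) (agrees k k<) ⟨
      pre ++ φ (s k) ++ concatMap φ (drop (suc k) xs)            ≡⟨ ++-assoc pre (φ (s k)) _ ⟨
      (pre ++ φ (s k)) ++ concatMap φ (drop (suc k) xs)          ∎) ,
    trans (length-++ pre) (trans (+-comm (length pre) _) (cong (length (φ (s k)) +_) len))
    where open ≡-Reasoning

  nth-concatMap : ∀ z k d → k < length xs → d < length (φ (s k)) →
    d + offset φ s k < length (concatMap φ xs) ×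
    nth z (concatMap φ xs) (d + offset φ s k) ≡ nth z (φ (s k)) d
  nth-concatMap z k d k< d<
    with pre , eq , len ← concatMap-split k (<⇒≤ k<)
    rewrite eq | sym len | drop-nth l0 xs k< | sym (agrees k k<) =
    (begin-strict
      d + length pre                                         ≡⟨ +-comm d _ ⟩
      length pre + d                                         <⟨ +-monoʳ-< (length pre) d< ⟩
      length pre + length (φ (s k))                          ≤⟨ +-monoʳ-≤ (length pre) (m≤m+n _ _) ⟩
      length pre + (length (φ (s k)) + length rest)          ≡⟨ cong (length pre +_) (length-++ (φ (s k))) ⟨
      length pre + length (φ (s k) ++ rest)                  ≡⟨ length-++ pre ⟨
      length (pre ++ φ (s k) ++ rest)                        ∎) ,
    trans (nth-++ʳ z pre _ d) (nth-++ˡ z (φ (s k)) rest d<)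
    where
    open ≤-Reasoning
    rest = concatMap φ (drop (suc k) xs)

concatMap-extends : {A : Set} (φ : Fin 3 → List A) → ∀ n →
  ∃[ r ] concatMap φ (prefix (suc n)) ≡ concatMap φ (prefix n) ++ r
concatMap-extends φ n with r , eq ← prefix-extends n =
  concatMap φ r , trans (cong (concatMap φ) eq) (concatMap-++ φ (prefix n) r)

hω-nth : ∀ n i → i < length (prefix n) → hω i ≡ nth l0 (prefix n) i
hω-nth = Limit.nth-limit l0 prefix prefix-extends prefix-long

-- `prefix k` has more than k letters, so its image already contains the whole block k.
limit-IsImage : {A : Set} (φ : Fin 3 → List A) (z : A) (w : ℕ → A) →
  (∀ n i → i < length (concatMap φ (prefix n)) → w i ≡ nth z (concatMap φ (prefix n)) i) →
  IsImage φ z hω w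
limit-IsImage φ z w w-nth k d d<
  with i< , eq ← nth-concatMap φ hω (prefix k) (hω-nth k) z k d (prefix-long k) d< =
  trans (w-nth k _ i<) eq

hω-image : IsImage hL l0 hω hω
hω-image = limit-IsImage hL l0 hω (λ n → hω-nth (suc n))

u-image : IsImage fg b0 hω u
u-image = limit-IsImage fg b0 u λ n i i< →
  trans (cong (λ xs → nth b0 xs i) (fg-concatMap (prefix (suc i))))
        (Limit.nth-limit b0 (λ n → concatMap fg (prefix n)) (concatMap-extends fg)
          (λ n → ≤-trans (prefix-long n) (≤-trans (m≤m+n _ _) (concatMap-long fg fg-long (prefix n)))) n i i<)

offset-cancel-< : {A : Set} (φ : Fin 3 → List A) → (∀ x → 2 ≤ length (φ x)) → ∀ s {k l} →
                  offset φ s k < offset φ s l → k < l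
offset-cancel-< φ φ-long s {k} {l} lt with k <? l
... | yes k<l = k<l
... | no  k≮l with q , refl ← ≤⇒∃+ (≮⇒≥ k≮l) =
  contradiction lt (≤⇒≯ (≤-trans (m≤n+m _ (2 * q)) (offset-grows φ φ-long s q l)))

-- Agreements between two positions of a word

Agree : {A : Set} → (ℕ → A) → ℕ → ℕ → ℕ → Set
Agree w i j n = ∀ t → t < n → w (t + i) ≡ w (t + j)

module _ {A : Set} (w : ℕ → A) where

  Agree-shorten : ∀ {i j m n} → m ≤ n → Agree w i j n → Agree w i j m
  Agree-shorten m≤n agr t t< = agr t (≤-trans t< m≤n)

  Agree-drop : ∀ c {i j n} → Agree w i j (c + n) → Agree w (c + i) (c + j) n
  Agree-drop c {i} {j} agr t t< = subst₂ (λ a b → w a ≡ w b) (swap i) (swap j) (agr (c + t) (+-monoʳ-< c t<))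
    where
    swap : ∀ i → c + t + i ≡ t + (c + i)
    swap i = trans (cong (_+ i) (+-comm c t)) (+-assoc t c i)

  Agree-join : ∀ m {i j n} → Agree w i j m → Agree w (m + i) (m + j) n → Agree w i j (m + n)
  Agree-join m {i} {j} agr agr′ t t< with t <? m
  ... | yes t<m = agr t t<m
  ... | no  t≮m with r , refl ← m≤n⇒∃[o]m+o≡n (≮⇒≥ t≮m) =
    subst₂ (λ a b → w a ≡ w b) (swap i) (swap j) (agr′ r (+-cancelˡ-< m _ _ t<))
    where
    swap : ∀ i → r + (m + i) ≡ m + r + i
    swap i = trans (sym (+-assoc r m i)) (cong (_+ i) (+-comm r m))

agree⇒power : ∀ {A : Set} (w : ℕ → A) {i p c} a b → 1 ≤ p → Agree w i (p + i) c → a * p ≤ (p + c) * b → ContainsPower w a b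
agree⇒power w {i} {p} {c} a b 1≤p agr ratio = i , p + c , p , ≤-trans 1≤p (m≤m+n p c) , 1≤p , periodic , ratio
  where
  lemma : ∀ i j p → j + (p + i) ≡ i + j + p
  lemma = solve-∀
  periodic : ∀ j → j + p < p + c → w (i + j) ≡ w (i + j + p)
  periodic j j< = subst₂ (λ m n → w m ≡ w n) (+-comm j i) (lemma i j p)
    (agr j (+-cancelʳ-< p j c (≤-trans j< (≤-reflexive (+-comm p c)))))

module _ {A : Set} (φ : Fin 3 → List A) (z : A) (s : ℕ → Fin 3) (w : ℕ → A) (image : IsImage φ z s w) where

  block-agree : ∀ {k l} → s k ≡ s l → Agree w (offset φ s k) (offset φ s l) (length (φ (s k)))
  block-agree {k} {l} eq t t< = trans (image k t t<) (trans (cong (λ x → nth z (φ x) t) eq)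
    (sym (image l t (subst (λ x → t < length (φ x)) eq t<))))

  image-agree : ∀ n {i j} → Agree s i j n →
    ∃[ m ] (Agree w (offset φ s i) (offset φ s j) m × m + offset φ s i ≡ offset φ s (n + i) × m + offset φ s j ≡ offset φ s (n + j))
  image-agree zero    agr = 0 , (λ _ ()) , refl , refl
  image-agree (suc n) {i} {j} agr with m , agr′ , eqᵢ , eqⱼ ← image-agree n {i} {j} (Agree-shorten s (n≤1+n n) agr) =
    m + len , Agree-join w m agr′ (subst₂ (λ a b → Agree w a b len) (sym eqᵢ) (sym eqⱼ) (block-agree last)) ,
    end (offset φ s i) eqᵢ , trans (end (offset φ s j) eqⱼ) (cong (λ x → length (φ x) + offset φ s (n + j)) last)
    where
    last = agr n ≤-refl
    len = length (φ (s (n + i)))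
    end : ∀ p {q} → m + p ≡ q → m + len + p ≡ len + q
    end p refl = trans (cong (_+ p) (+-comm m len)) (+-assoc len m p)

-- Finite checks on the blocks of f ∘ g.

Apart : Fin 3 → Fin 3 → Set
Apart x y = ¬ (x ≡ 0F × y ≡ 0F)

apart? : ∀ x y → Dec (Apart x y)
apart? x y = ¬? ((x Fin.≟ 0F) ×-dec (y Fin.≟ 0F))

-- The constant 17/10 lies just below 1 + √2/2.
Mismatch : List (Fin 2) → ℕ → ℕ → Set
Mismatch w d p = ∃[ n ] (n < suc (17 * p / 10) × n + (p + d) < length w × nth b0 w (n + d) ≢ nth b0 w (n + (p + d)))

mismatch? : ∀ w d p → Dec (Mismatch w d p)
mismatch? w d p = anyUpTo? (λ n → (n + (p + d) <? length w) ×-dec ¬? (nth b0 w (n + d) Fin.≟ nth b0 w (n + (p + d)))) _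

-- Opaque because with-abstractions would otherwise unfold the finite check.
opaque
  short-mismatch : ∀ x₀ x₁ x₂ x₃ → Apart x₀ x₁ → Apart x₁ x₂ → Apart x₂ x₃ →
    ∀ {d} → d < length (fg x₀) → ∀ {p} → p < 7 → Mismatch (fg x₀ ++ fg x₁ ++ fg x₂ ++ fg x₃ ++ []) d (suc p)
  short-mismatch = toWitness {a? =
    -- Four blocks always suffice: n ≤ 11 and a period of at most 7 reach at most 18 letters past
    -- the offset `d`, and three blocks without two adjacent 0s behind the first one have at least 5
    -- + 8 + 5 = 18 letters.
    Fin.all? λ x₀ → Fin.all? λ x₁ → Fin.all? λ x₂ → Fin.all? λ x₃ →
    apart? x₀ x₁ →-dec apart? x₁ x₂ →-dec apart? x₂ x₃ →-dec
    allUpTo? (λ d → allUpTo? (λ p → mismatch? (fg x₀ ++ fg x₁ ++ fg x₂ ++ fg x₃ ++ []) d (suc p)) 7) (length (fg x₀))} _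

-- Every block begins with 00, has no other 00 and ends in 1, so a 00 in the image never straddles
-- two blocks.
block-start? : ∀ x {d} → d < length (fg x) → nth b0 (fg x) d ≡ 0F →
  suc d < length (fg x) × (nth b0 (fg x) (suc d) ≡ 0F → d ≡ 0)
block-start? = toWitness {a? = Fin.all? λ x → allUpTo? (λ d →
  (nth b0 (fg x) d Fin.≟ 0F) →-dec ((suc d <? length (fg x)) ×-dec ((nth b0 (fg x) (suc d) Fin.≟ 0F) →-dec (d ≟ 0)))) (length (fg x))} _

wx wy : Fin 3 → ℕ
wx 0F = 1
wx 1F = 0
wx 2F = 1
wy 0F = 0
wy 1F = 1
wy 2F = 1

fg-length : ∀ x → length (fg x) ≡ 5 * wx x + 8 * wy x
fg-length 0F = refl
fg-length 1F = refl
fg-length 2F = refl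

fg-short : ∀ x → length (fg x) ≤ 13
fg-short 0F = m≤m+n 5 8
fg-short 1F = m≤m+n 8 5
fg-short 2F = ≤-refl

-- The hypotheses give 10e ≤ 7p, and 2 · 49 < 100.
ratio⇒subcritical : ∀ p a e → 1 ≤ p → 10 * a ≤ 17 * p → p + e ≤ a → 2 * (e * e) < p * p
ratio⇒subcritical p a e 1≤p h e≤ = *-cancelˡ-< 50 _ _ (begin-strict
  50 * (2 * (e * e))      ≡⟨ lemma₁ e ⟩
  10 * e * (10 * e)       ≤⟨ *-mono-≤ lt lt ⟩
  7 * p * (7 * p)         ≡⟨ lemma₂ p ⟩
  49 * (p * p)            <⟨ m<n+m (49 * (p * p)) (*-mono-≤ 1≤p 1≤p) ⟩
  50 * (p * p)            ∎)
  where
  open ≤-Reasoning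
  lt : 10 * e ≤ 7 * p
  lt = linear 0 (+-mono-≤ h (*-monoʳ-≤ 10 e≤)) (lemma p a e)
    where
    lemma : ∀ p a e → 7 * p + (10 * a + 10 * (p + e)) ≡ 10 * e + (17 * p + 10 * a) + 0
    lemma = solve-∀
  lemma₁ : ∀ e → 50 * (2 * (e * e)) ≡ 10 * e * (10 * e)
  lemma₁ = solve-∀
  lemma₂ : ∀ p → 7 * p * (7 * p) ≡ 49 * (p * p)
  lemma₂ = solve-∀

-- An end of an agreement carries the flag cross if the letters just outside are known to be
-- 1 and 2. Twice the corrections are (1 , ly) at the left end and (1 , ry) at the right end;
-- they solve c = λd, e + d = λc with λ = 1 + √2, where e is the extension that a crossed end
-- gains under h, and similarly on the right.
data Flag : Set where
  any cross : Flag

ly ry : Flag → ℕ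
ly any   = 0
ly cross = 1
ry any   = 1
ry cross = 2

Cross : Fin 3 → Fin 3 → Set
Cross x y = (x ≡ 1F × y ≡ 2F) ⊎ (x ≡ 2F × y ≡ 1F)

Cross-≢0ˡ : ∀ {x y} → Cross x y → x ≢ 0F
Cross-≢0ˡ (inj₁ (refl , _)) ()
Cross-≢0ˡ (inj₂ (refl , _)) ()

Cross-≢0ʳ : ∀ {x y} → Cross x y → y ≢ 0F
Cross-≢0ʳ (inj₁ (_ , refl)) ()
Cross-≢0ʳ (inj₂ (_ , refl)) ()

Cross-≢ : ∀ {x y} → Cross x y → x ≢ y
Cross-≢ (inj₁ (refl , refl)) ()
Cross-≢ (inj₂ (refl , refl)) ()

-- Agreements in the fixed point of h

module Ternary (v : ℕ → Fin 3) (v-image : IsImage hL l0 v v) where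

  pos : ℕ → ℕ
  pos = offset hL v

  X Y : ℕ → ℕ
  X zero    = 0
  X (suc n) = wx (v n) + X n
  Y zero    = 0
  Y (suc n) = wy (v n) + Y n

  pos-suc : ∀ {k x} → v k ≡ x → pos (suc k) ≡ length (hL x) + pos k
  pos-suc {k} eq = cong (λ x → length (hL x) + pos k) eq

  letter : ∀ d {k x} {d< : True (d <? length (hL x))} → v k ≡ x → v (d + pos k) ≡ nth l0 (hL x) d
  letter d {k} {d< = d<} refl = v-image k d (toWitness d<)

  start : ∀ k → v (pos k) ≡ 0F
  start k with v k in eq
  ... | 0F = letter 0 eq
  ... | 1F = letter 0 eq
  ... | 2F = letter 0 eq

  next-start : ∀ {k x} → v k ≡ x → v (length (hL x) + pos k) ≡ 0F
  next-start {k} eq = trans (cong v (sym (pos-suc eq))) (start (suc k))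

  X-pos : ∀ k → X (pos k) ≡ X k + 2 * Y k
  X-pos zero    = refl
  X-pos (suc k) with v k in eq
  ... | 0F rewrite letter 1 eq | letter 0 eq | X-pos k = refl
  ... | 1F rewrite letter 1 eq | letter 0 eq | X-pos k = lemma (X k) (Y k)
    where
    lemma : ∀ x y → 2 + (x + 2 * y) ≡ x + 2 * (1 + y)
    lemma = solve-∀
  ... | 2F rewrite letter 2 eq | letter 1 eq | letter 0 eq | X-pos k = lemma (X k) (Y k)
    where
    lemma : ∀ x y → 3 + (x + 2 * y) ≡ 1 + x + 2 * (1 + y)
    lemma = solve-∀

  Y-pos : ∀ k → Y (pos k) ≡ X k + Y k
  Y-pos zero    = refl
  Y-pos (suc k) with v k in eq
  ... | 0F rewrite letter 1 eq | letter 0 eq | Y-pos k = refl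
  ... | 1F rewrite letter 1 eq | letter 0 eq | Y-pos k = sym (+-suc (X k) (Y k))
  ... | 2F rewrite letter 2 eq | letter 1 eq | letter 0 eq | Y-pos k = cong suc (sym (+-suc (X k) (Y k)))

  period-posX : ∀ {k l x y} → X l ≡ X k + x → Y l ≡ Y k + y → X (pos l) ≡ X (pos k) + (x + 2 * y)
  period-posX {k} {l} {x} {y} eqx eqy = trans (X-pos l) (trans (cong₂ (λ a b → a + 2 * b) eqx eqy)
    (trans (lemma (X k) (Y k) x y) (cong (_+ (x + 2 * y)) (sym (X-pos k)))))
    where
    lemma : ∀ X Y x y → X + x + 2 * (Y + y) ≡ X + 2 * Y + (x + 2 * y)
    lemma = solve-∀

  period-posY : ∀ {k l x y} → X l ≡ X k + x → Y l ≡ Y k + y → Y (pos l) ≡ Y (pos k) + (x + y)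
  period-posY {k} {l} {x} {y} eqx eqy = trans (Y-pos l) (trans (cong₂ _+_ eqx eqy)
    (trans (lemma (X k) (Y k) x y) (cong (_+ (x + y)) (sym (Y-pos k)))))
    where
    lemma : ∀ X Y x y → X + x + (Y + y) ≡ X + Y + (x + y)
    lemma = solve-∀

  X-start : ∀ k → X (1 + pos k) ≡ 1 + (X k + 2 * Y k)
  X-start k rewrite start k = cong suc (X-pos k)

  Y-start : ∀ k → Y (1 + pos k) ≡ X k + Y k
  Y-start k rewrite start k = Y-pos k

  -- Desubstitution at the right end of an agreement.

  RightCtx : Flag → ℕ → ℕ → Set
  RightCtx any   i j = ⊤
  RightCtx cross i j = Cross (v i) (v j)

  LeftCtx : Flag → ℕ → ℕ → Set
  LeftCtx any   i j = ⊤
  LeftCtx cross i j = ∃[ i′ ] ∃[ j′ ] (i ≡ suc i′ × j ≡ suc j′ × Cross (v i′) (v j′))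

  -- The two bounds are the coordinates of one inequality in ℤ[√2]: twice the end `e` plus 1 +
  -- `ry R`√2 is at most 1 + √2 times the same expression at the desubstituted end `length′ + k`
  -- with `flag`.
  record RightDescent (k l : ℕ) (R : Flag) (e : ℕ) : Set where
    constructor descent
    field
      length′ : ℕ
      flag    : Flag
      agree   : Agree v k l length′
      ctx     : RightCtx flag (length′ + k) (length′ + l)
      boundX  : X e ≤ X (length′ + k) + 2 * Y (length′ + k) + ry flag
      boundY  : 2 * Y e + ry R ≤ 2 * X (length′ + k) + 1 + 2 * Y (length′ + k) + ry flag

  Agree-empty : ∀ {i j} → Agree v i j 0
  Agree-empty t ()

  Agree-cons : ∀ {i j n} → v i ≡ v j → Agree v (suc i) (suc j) n → Agree v i j (suc n)
  Agree-cons eq agr = Agree-join v 1 (λ { zero _ → eq ; (suc _) (s≤s ()) }) agr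

  RightDescent-cons : ∀ {k l R e} → v k ≡ v l → RightDescent (suc k) (suc l) R e → RightDescent k l R e
  RightDescent-cons {k} {l} eq (descent n F agr ctx bx by)
    rewrite +-suc n k | +-suc n l = descent (suc n) F (Agree-cons eq agr) ctx bx by

  Agree-next : ∀ {k l x n} → v k ≡ x → v l ≡ x →
    Agree v (pos k) (pos l) (length (hL x) + n) → Agree v (pos (suc k)) (pos (suc l)) n
  Agree-next {x = x} vk vl agr rewrite pos-suc vk | pos-suc vl = Agree-drop v (length (hL x)) agr

  end-next : ∀ {k x n e} → v k ≡ x → e ≡ length (hL x) + n + pos k → e ≡ n + pos (suc k)
  end-next {k} {x} {n} vk refl rewrite pos-suc vk =
    trans (cong (_+ pos k) (+-comm (length (hL x)) n)) (+-assoc n _ (pos k))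

  ry≤2 : ∀ R → ry R ≤ 2
  ry≤2 any   = s≤s z≤n
  ry≤2 cross = s≤s (s≤s z≤n)

  Cross-second : ∀ {k y} → Cross (v k) y → v (1 + pos k) ≡ 2F
  Cross-second (inj₁ (vk , _)) = letter 1 vk
  Cross-second (inj₂ (vk , _)) = letter 1 vk

  -- A block h(1) is followed by a 0, so the two sides read 020 and 022 in some order and the
  -- agreement stops after 02. This is where a crossed end arises, and both bounds are then
  -- equalities.
  right-mixed : ∀ n {k l e f} R → Cross (v k) (v l) → Agree v (pos k) (pos l) (2 + n) →
    e ≡ 2 + n + pos k → f ≡ 2 + n + pos l → RightCtx R e f → RightDescent k l R e
  right-mixed (suc n) R (inj₁ (vk , vl)) agr refl refl c
    with () ← trans (sym (next-start vk)) (trans (agr 2 (s≤s (s≤s (s≤s z≤n)))) (letter 2 vl))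
  right-mixed (suc n) R (inj₂ (vk , vl)) agr refl refl c
    with () ← trans (sym (letter 2 vk)) (trans (agr 2 (s≤s (s≤s (s≤s z≤n)))) (next-start vl))
  right-mixed zero cross (inj₁ (vk , vl)) agr refl refl c = contradiction (next-start vk) (Cross-≢0ˡ c)
  right-mixed zero cross (inj₂ (vk , vl)) agr refl refl c = contradiction (next-start vl) (Cross-≢0ʳ c)
  right-mixed zero {k} any vk×vl agr refl refl c = descent 0 cross Agree-empty vk×vl
    (≤-reflexive X-end) (≤-reflexive (trans (cong (λ y → 2 * y + 1) Y-end) (lemma (X k) (Y k))))
    where
    X-end : X (2 + pos k) ≡ X k + 2 * Y k + 2
    X-end rewrite Cross-second vk×vl | start k | X-pos k = +-comm 2 _

    Y-end : Y (2 + pos k) ≡ 1 + (X k + Y k)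
    Y-end rewrite Cross-second vk×vl | start k | Y-pos k = refl

    lemma : ∀ x y → 2 * (1 + (x + y)) + 1 ≡ 2 * x + 1 + 2 * y + 2
    lemma = solve-∀

  right-twos : ∀ n {k l e f} R → v k ≡ 2F → v l ≡ 2F → Agree v (pos k) (pos l) (2 + n) →
    e ≡ 2 + n + pos k → f ≡ 2 + n + pos l → RightCtx R e f → RightDescent k l R e
  -- Two letters decide whether a block comes from 0, since h(0) has second letter 1 while h(1) and
  -- h(2) have 2; only the pair 1, 2 needs the third letter. Shorter agreements stop with `any`.
  right-descent : ∀ n {k l e f} R → Agree v (pos k) (pos l) n → e ≡ n + pos k → f ≡ n + pos l →
                  RightCtx R e f → RightDescent k l R e
  right-descent zero {k} cross _ refl refl c = contradiction (start k) (Cross-≢0ˡ c)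
  right-descent zero {k} any _ refl refl c = descent 0 any Agree-empty tt
    (≤-trans (≤-reflexive (X-pos k)) (m≤m+n _ 1))
    (≤-trans (≤-reflexive (cong (λ y → 2 * y + 1) (Y-pos k))) (linear 1 z≤n (lemma (X k) (Y k))))
    where
    lemma : ∀ x y → 2 * x + 1 + 2 * y + 1 + 0 ≡ 2 * (x + y) + 1 + 0 + 1
    lemma = solve-∀
  right-descent (suc zero) {k} R _ refl refl c = descent 0 any Agree-empty tt
    (≤-reflexive (trans (X-start k) (+-comm 1 _)))
    (≤-trans (≤-reflexive (cong (λ y → 2 * y + ry R) (Y-start k))) (linear 0 (ry≤2 R) (lemma (X k) (Y k) (ry R))))
    where
    lemma : ∀ x y r → 2 * x + 1 + 2 * y + 1 + r ≡ 2 * (x + y) + r + 2 + 0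
    lemma = solve-∀
  right-descent (suc (suc n)) {k} {l} R agr e≡ f≡ c = by-letters (v k) (v l) refl refl
    where
    2nd : v (1 + pos k) ≡ v (1 + pos l)
    2nd = agr 1 (s≤s (s≤s z≤n))

    by-letters : ∀ x y → v k ≡ x → v l ≡ y → RightDescent k l R _
    by-letters 0F 0F vk vl = RightDescent-cons (trans vk (sym vl))
      (right-descent n R (Agree-next vk vl agr) (end-next vk e≡) (end-next vl f≡) c)
    by-letters 1F 1F vk vl = RightDescent-cons (trans vk (sym vl))
      (right-descent n R (Agree-next vk vl agr) (end-next vk e≡) (end-next vl f≡) c)
    by-letters 2F 2F vk vl = right-twos n R vk vl agr e≡ f≡ c
    by-letters 1F 2F vk vl = right-mixed n R (inj₁ (vk , vl)) agr e≡ f≡ c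
    by-letters 2F 1F vk vl = right-mixed n R (inj₂ (vk , vl)) agr e≡ f≡ c
    by-letters 0F 1F vk vl with () ← trans (sym (letter 1 vk)) (trans 2nd (letter 1 vl))
    by-letters 0F 2F vk vl with () ← trans (sym (letter 1 vk)) (trans 2nd (letter 1 vl))
    by-letters 1F 0F vk vl with () ← trans (sym (letter 1 vk)) (trans 2nd (letter 1 vl))
    by-letters 2F 0F vk vl with () ← trans (sym (letter 1 vk)) (trans 2nd (letter 1 vl))

  right-twos zero cross vk vl _ refl refl c = contradiction (trans (letter 2 vk) (sym (letter 2 vl))) (Cross-≢ c)
  right-twos zero {k} any vk vl _ refl refl c =
    -- Both letters are 2, so the whole block may be counted although the agreement was followed
    -- only through 02: just an upper bound on the end is needed.
    descent 1 any (Agree-cons (trans vk (sym vl)) Agree-empty) tt boundX boundY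
    where
    boundX : X (2 + pos k) ≤ X (1 + k) + 2 * Y (1 + k) + 1
    boundX rewrite letter 1 vk | start k | X-pos k | vk = linear 2 z≤n (lemma (X k) (Y k))
      where
      lemma : ∀ x y → 1 + x + 2 * (1 + y) + 1 + 0 ≡ 2 + (x + 2 * y) + 0 + 2
      lemma = solve-∀

    boundY : 2 * Y (2 + pos k) + 1 ≤ 2 * X (1 + k) + 1 + 2 * Y (1 + k) + 1
    boundY rewrite letter 1 vk | start k | Y-pos k | vk = linear 3 z≤n (lemma (X k) (Y k))
      where
      lemma : ∀ x y → 2 * (1 + x) + 1 + 2 * (1 + y) + 1 + 0 ≡ 2 * (1 + (x + y)) + 1 + 0 + 3
      lemma = solve-∀
  right-twos (suc n) R vk vl agr e≡ f≡ c = RightDescent-cons (trans vk (sym vl))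
    (right-descent n R (Agree-next vk vl agr) (end-next vk e≡) (end-next vl f≡) c)

  -- Positions inside h-blocks and short factors.

  data Located : ℕ → Set where
    at0 : ∀ k → Located (pos k)
    at1 : ∀ k → Located (1 + pos k)
    at2 : ∀ k → v k ≡ 2F → Located (2 + pos k)

  locate : ∀ n → Located n
  locate zero = at0 0
  locate (suc n) with locate n
  ... | at0 k = at1 k
  ... | at2 k vk = subst Located (pos-suc vk) (at0 (suc k))
  ... | at1 k with v k in vk
  ...   | 0F = subst Located (pos-suc vk) (at0 (suc k))
  ...   | 1F = subst Located (pos-suc vk) (at0 (suc k))
  ...   | 2F = at2 k vk

  second-≢0 : ∀ k → v (1 + pos k) ≢ 0F
  second-≢0 k eq with v k in vk
  ... | 0F with () ← trans (sym (letter 1 vk)) eq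
  ... | 1F with () ← trans (sym (letter 1 vk)) eq
  ... | 2F with () ← trans (sym (letter 1 vk)) eq

  no-00 : ∀ n → v n ≡ 0F → v (suc n) ≢ 0F
  no-00 n eq with locate n
  ... | at0 k = second-≢0 k
  ... | at1 k = contradiction eq (second-≢0 k)
  ... | at2 k vk with () ← trans (sym eq) (letter 2 vk)

  -- Every 1 is the last letter of an h(0), so its neighbours are 0.
  no-cross : ∀ n → ¬ Cross (v n) (v (suc n))
  no-cross n c with locate n
  ... | at0 k = Cross-≢0ˡ c (start k)
  ... | at2 k vk = Cross-≢0ʳ c (next-start vk)
  ... | at1 k with v k in vk
  ...   | 0F = Cross-≢0ʳ c (next-start vk)
  ...   | 1F = Cross-≢0ʳ c (next-start vk)
  ...   | 2F = Cross-≢ c (trans (letter 1 vk) (sym (letter 2 vk)))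

  X-suc : ∀ {n} x → v n ≡ x → X (suc n) ≡ X n + wx x
  X-suc x refl = +-comm (wx x) _

  Y-suc : ∀ {n} x → v n ≡ x → Y (suc n) ≡ Y n + wy x
  Y-suc x refl = +-comm (wy x) _

  X-mono : ∀ n i → X i ≤ X (n + i)
  X-mono zero    i = ≤-refl
  X-mono (suc n) i = ≤-trans (X-mono n i) (m≤n+m _ _)

  Y-mono : ∀ n i → Y i ≤ Y (n + i)
  Y-mono zero    i = ≤-refl
  Y-mono (suc n) i = ≤-trans (Y-mono n i) (m≤n+m _ _)

  -- The factors of length two are 01 and 10, of weight (1 , 1), and 02, 20 and 22, of weight at
  -- least (2 , 1).
  two-letters : ∀ i → (X (2 + i) ≡ 1 + X i × Y (2 + i) ≡ 1 + Y i) ⊎ (2 + X i ≤ X (2 + i) × 1 + Y i ≤ Y (2 + i))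
  two-letters i with locate i
  ... | at0 k with v k in vk
  ...   | 0F rewrite letter 1 vk | letter 0 vk = inj₁ (refl , refl)
  ...   | 1F rewrite letter 1 vk | letter 0 vk = inj₂ (≤-refl , ≤-refl)
  ...   | 2F rewrite letter 1 vk | letter 0 vk = inj₂ (≤-refl , ≤-refl)
  two-letters i | at1 k with v k in vk
  ...   | 0F rewrite next-start vk | letter 1 vk = inj₁ (refl , refl)
  ...   | 1F rewrite next-start vk | letter 1 vk = inj₂ (≤-refl , ≤-refl)
  ...   | 2F rewrite letter 2 vk | letter 1 vk = inj₂ (≤-refl , n≤1+n _)
  two-letters i | at2 k vk rewrite next-start vk | letter 2 vk = inj₂ (≤-refl , ≤-refl)

  -- The hypothesis selects 01 and 10. After 01 a new block starts with 0; after 10 comes a 2,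
  -- because 101 would desubstitute to the factor 00.
  third-letter : ∀ i → X (2 + i) ≡ 1 + X i → wx (v (2 + i)) ≡ 1
  third-letter i eq with locate i
  ... | at0 k with v k in vk
  ...   | 0F = cong wx (next-start vk)
  ...   | 1F rewrite letter 1 vk | letter 0 vk = contradiction eq 1+n≢n
  ...   | 2F = cong wx (letter 2 vk)
  third-letter i eq | at1 k with v k in vk
  ...   | 1F rewrite next-start vk | letter 1 vk = contradiction eq 1+n≢n
  ...   | 2F = cong wx (next-start vk)
  ...   | 0F rewrite sym (pos-suc vk) with v (suc k) in vk′
  ...     | 0F = contradiction vk′ (no-00 k vk)
  ...     | 1F = cong wx (letter 1 vk′)
  ...     | 2F = cong wx (letter 1 vk′)
  third-letter i eq | at2 k vk rewrite next-start vk | letter 2 vk = contradiction eq 1+n≢n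

  three-letters : ∀ i → 2 + X i ≤ X (3 + i) × 1 + Y i ≤ Y (3 + i)
  three-letters i with two-letters i
  ... | inj₂ (x≥ , y≥) = ≤-trans x≥ (X-mono 1 (2 + i)) , ≤-trans y≥ (Y-mono 1 (2 + i))
  ... | inj₁ (x≡ , y≡) = ≤-reflexive (sym (cong₂ _+_ (third-letter i x≡) x≡)) , ≤-trans (≤-reflexive (sym y≡)) (Y-mono 1 (2 + i))

  difference : ∀ {p a b} → p + a ≤ b → ∃[ x ] (b ≡ a + x × p ≤ x)
  difference {p} {a} {b} le with q , refl ← m≤n⇒∃[o]m+o≡n le =
    p + q , trans (cong (_+ q) (+-comm p a)) (+-assoc a p q) , m≤m+n p q

  -- `c` and `d` carry the corrections of both ends: `c` is the sum of the doubled √2-coordinates,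
  -- and `d` is half the sum of the doubled rational ones, hence 1 for the standard corrections. So
  -- `γ` is doubled and `β` is not.
  record Bounded (i j e c d : ℕ) : Set where
    constructor bounded
    field
      {β γ x y} : ℕ
      good      : Good β γ x y
      periodX   : X j ≡ X i + x
      periodY   : Y j ≡ Y i + y
      boundX    : X e + d ≤ X i + β
      boundY    : 2 * Y e + c ≤ 2 * Y i + γ

  -- Agreements of length at most one.

  data Period (i j : ℕ) : Set where
    letter-period : j ≡ suc i → Period i j
    word-period   : ∀ {x y} → X j ≡ X i + x → Y j ≡ Y i + y →
                    (x ≡ 1 × y ≡ 1) ⊎ (2 ≤ x × 1 ≤ y) → Period i j

  long-period : ∀ {i j} → 2 + X i ≤ X j → 1 + Y i ≤ Y j → Period i j
  long-period x≥ y≥ with x , eqx , 2≤x ← difference x≥ | y , eqy , 1≤y ← difference y≥ =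
    word-period eqx eqy (inj₂ (2≤x , 1≤y))

  period : ∀ {i j} → i < j → Period i j
  period {i} i<j with ≤⇒∃+ i<j
  ... | zero , refl = letter-period refl
  ... | suc zero , refl with two-letters i
  ...   | inj₁ (x≡ , y≡) = word-period (trans x≡ (+-comm 1 _)) (trans y≡ (+-comm 1 _)) (inj₁ (refl , refl))
  ...   | inj₂ (x≥ , y≥) = long-period x≥ y≥
  period {i} i<j | suc (suc q) , refl with x≥ , y≥ ← three-letters i =
    long-period (subst (λ n → 2 + X i ≤ X n) (swap q i) (≤-trans x≥ (X-mono q (3 + i))))
                (subst (λ n → 1 + Y i ≤ Y n) (swap q i) (≤-trans y≥ (Y-mono q (3 + i))))
    where
    swap : ∀ q i → q + (3 + i) ≡ 2 + q + suc i
    swap = solve-∀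

  -- The period (1 , 1) has norm -1, and 2, 3 are its tight values; from (2 , 1) on the same values
  -- are slack.
  word-period-bounded : ∀ {i j e c x y} → X j ≡ X i + x → Y j ≡ Y i + y → (x ≡ 1 × y ≡ 1) ⊎ (2 ≤ x × 1 ≤ y) →
                        X e ≤ 1 + X i → 2 * Y e + c ≤ 2 * Y i + 3 → Bounded i j e c 1
  word-period-bounded {i} {e = e} eqx eqy xy hX hY = bounded (good xy) eqx eqy (linear 0 hX (lemma (X i) (X e))) hY
    where
    lemma : ∀ x e → x + 2 + e ≡ e + 1 + (1 + x) + 0
    lemma = solve-∀
    good : ∀ {x y} → (x ≡ 1 × y ≡ 1) ⊎ (2 ≤ x × 1 ≤ y) → Good 2 3 x y
    good (inj₁ (refl , refl)) = tight (inj₂ refl)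
    good (inj₂ (2≤x , 1≤y)) = slack (≤-trans (m≤m+n 6 4) (*-monoʳ-≤ 5 2≤x)) (≤-trans (m≤m+n 9 1) (*-monoʳ-≤ 10 1≤y))

  ly+ry≤3 : ∀ L R → ly L + ry R ≤ 3
  ly+ry≤3 any   any   = s≤s z≤n
  ly+ry≤3 any   cross = s≤s (s≤s z≤n)
  ly+ry≤3 cross any   = s≤s (s≤s z≤n)
  ly+ry≤3 cross cross = s≤s (s≤s (s≤s z≤n))

  empty-bounded : ∀ {i j} L R → i < j → LeftCtx L i j → RightCtx R i j → Bounded i j i (ly L + ry R) 1
  empty-bounded {i} L R i<j lc rc with period i<j
  ... | word-period eqx eqy xy = word-period-bounded eqx eqy xy (n≤1+n _) (+-monoʳ-≤ (2 * Y i) (ly+ry≤3 L R))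
  ... | letter-period refl = letters L R lc rc
    where
    letters : ∀ L R → LeftCtx L i (suc i) → RightCtx R i (suc i) → Bounded i (suc i) i (ly L + ry R) 1
    letters L     cross _ rc = contradiction rc (no-cross i)
    letters cross any (i′ , _ , refl , refl , c) _ = contradiction c (no-cross i′)
    letters any   any _ _ with v i in vi
    ... | 0F = bounded (tight {1} {0} (inj₁ refl)) (X-suc 0F vi) (Y-suc 0F vi) ≤-refl ≤-refl
    -- The period √2 has norm -2, and its zero rational coordinate rules out a bound that is slack
    -- coordinate by coordinate.
    ... | 1F = bounded seed (X-suc 1F vi) (Y-suc 1F vi) ≤-refl ≤-refl
    ... | 2F = bounded (tight {1} {1} (inj₂ refl)) (X-suc 2F vi) (Y-suc 2F vi) (+-monoʳ-≤ (X i) (s≤s z≤n)) (+-monoʳ-≤ (2 * Y i) (s≤s z≤n))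

  -- This serves a 2 that is the second letter of an h(2) on one side and the third letter of an
  -- h(2) on the other. In front and behind, one of the two neighbours is then a 0, so neither end
  -- is crossed.
  two-bounded : ∀ {i j} L R → i < j → v i ≡ 2F →
                (∀ {i′ j′} → i ≡ suc i′ → j ≡ suc j′ → ¬ Cross (v i′) (v j′)) →
                ¬ Cross (v (1 + i)) (v (1 + j)) →
                LeftCtx L i j → RightCtx R (1 + i) (1 + j) → Bounded i j (1 + i) (ly L + ry R) 1
  two-bounded L cross i<j vi before after lc rc = contradiction rc after
  two-bounded cross any i<j vi before after (_ , _ , i≡ , j≡ , c) rc = contradiction c (before i≡ j≡)
  two-bounded {i} any any i<j vi before after lc rc = bound (period i<j)
    where
    hX : X (1 + i) ≤ 1 + X i
    hX rewrite vi = ≤-refl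
    hY : 2 * Y (1 + i) + 1 ≤ 2 * Y i + 3
    hY rewrite vi = ≤-reflexive (lemma (Y i))
      where
      lemma : ∀ y → 2 * (1 + y) + 1 ≡ 2 * y + 3
      lemma = solve-∀
    bound : ∀ {j} → Period i j → Bounded i j (1 + i) 1 1
    bound (word-period eqx eqy xy) = word-period-bounded eqx eqy xy hX hY
    bound (letter-period refl) = word-period-bounded (X-suc 2F vi) (Y-suc 2F vi) (inj₁ (refl , refl)) hX hY

  -- The descent through h.

  lift : ∀ {k l a e L′ R R′} → Bounded k l (a + k) (ly L′ + ry R′) 1 →
    X e ≤ X (a + k) + 2 * Y (a + k) + ry R′ → 2 * Y e + ry R ≤ 2 * X (a + k) + 1 + 2 * Y (a + k) + ry R′ →
    Bounded (pos k) (pos l) e (1 + ly L′ + ry R) (1 + ly L′)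
  lift {k} {l} {a} {e} {L′} {R} {R′} (bounded {β} {γ} {x} {y} good eqx eqy hx hy) rx≤ ry≤ =
    bounded (Good-step good) (period-posX {k} {l} eqx eqy) (period-posY {k} {l} eqx eqy)
    (subst (λ z → X e + (1 + ly L′) ≤ z + (β + γ)) (sym (X-pos k))
      (linear 0 (+-mono-≤ rx≤ (+-mono-≤ hx hy)) (lemmaX (X e) (X (a + k)) (Y (a + k)) (X k) (Y k) β γ (ly L′) (ry R′))))
    (subst (λ z → 2 * Y e + (1 + ly L′ + ry R) ≤ 2 * z + (2 * β + γ)) (sym (Y-pos k))
      (linear 0 (+-mono-≤ ry≤ (+-mono-≤ (*-monoʳ-≤ 2 hx) hy)) (lemmaY (Y e) (X (a + k)) (Y (a + k)) (X k) (Y k) β γ (ly L′) (ry R) (ry R′))))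
    where
    lemmaX : ∀ E x y X Y β γ L R → X + 2 * Y + (β + γ) + (E + (x + 1 + (2 * y + (L + R))))
      ≡ E + (1 + L) + (x + 2 * y + R + (X + β + (2 * Y + γ))) + 0
    lemmaX = solve-∀
    lemmaY : ∀ E x y X Y β γ L r R → 2 * (X + Y) + (2 * β + γ) + (2 * E + r + (2 * (x + 1) + (2 * y + (L + R))))
      ≡ 2 * E + (1 + L + r) + (2 * x + 1 + 2 * y + R + (2 * (X + β) + (2 * Y + γ))) + 0
    lemmaY = solve-∀

  descend-period : ∀ {N k l} → pos k < pos l → pos l ≤ suc N + pos k → k < l × l ≤ N + k
  descend-period {N} {k} {l} lt le = k<l , l≤ (≤⇒∃+ k<l)
    where
    k<l = offset-cancel-< hL hL-long v lt
    l≤ : ∃[ q ] l ≡ q + suc k → l ≤ N + k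
    l≤ (q , refl) = linear q (≤-trans (offset-grows hL hL-long v (suc q) k) (subst (λ z → pos z ≤ suc N + pos k) (+-suc q k) le))
      (lemma N q k (pos k))
      where
      lemma : ∀ N q k p → N + k + (2 * suc q + p) ≡ q + suc k + (suc N + p) + q
      lemma = solve-∀

  shift-bounded : ∀ {i j e c} d {c′} → c′ ≤ c → X (d + j) + X i ≡ X (d + i) + X j → Y (d + j) + Y i ≡ Y (d + i) + Y j →
    Bounded i j e c 1 → Bounded (d + i) (d + j) e c′ 1
  shift-bounded {i} {j} {e} d c′≤c dx dy (bounded {x = x} {y} good eqx eqy hx hy) = bounded good
    (shift (X i) x eqx dx) (shift (Y i) y eqy dy)
    (≤-trans hx (+-monoˡ-≤ _ (X-mono d i)))
    (≤-trans (+-monoʳ-≤ (2 * Y e) c′≤c) (≤-trans hy (+-monoˡ-≤ _ (*-monoʳ-≤ 2 (Y-mono d i)))))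
    where
    shift : ∀ {a b c} p x → c ≡ p + x → b + p ≡ a + c → b ≡ a + x
    shift {a} {b} p x refl eq = +-cancelʳ-≡ p b (a + x) (trans eq (lemma a p x))
      where
      lemma : ∀ a p x → a + (p + x) ≡ a + x + p
      lemma = solve-∀

  count-agree : ∀ d {i j} → Agree v i j d → X (d + j) + X i ≡ X (d + i) + X j × Y (d + j) + Y i ≡ Y (d + i) + Y j
  count-agree zero    {i} {j} agr = +-comm (X j) (X i) , +-comm (Y j) (Y i)
  count-agree (suc d) {i} {j} agr with dx , dy ← count-agree d {i} {j} (Agree-shorten v (n≤1+n d) agr) =
    step (X (d + i)) (cong wx (agr d ≤-refl)) dx , step (Y (d + i)) (cong wy (agr d ≤-refl)) dy
    where
    step : ∀ {a b p q r} x → a ≡ b → p + q ≡ x + r → b + p + q ≡ a + x + r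
    step {a} {p = p} {q} {r} x refl eq = trans (+-assoc a p q) (trans (cong (a +_) eq) (sym (+-assoc a x r)))

  +-reassoc : ∀ {e n} d p → e ≡ n + (d + p) → e ≡ d + n + p
  +-reassoc {n = n} d p refl = trans (sym (+-assoc n d p)) (cong (_+ p) (+-comm n d))

  ly≤1 : ∀ L → ly L ≤ 1
  ly≤1 any   = z≤n
  ly≤1 cross = ≤-refl

  -- N bounds the period j − i, which at least halves in each descent.
  agreement-bounded : ∀ N {i j n e f} L R → i < j → j ≤ N + i → Agree v i j n → e ≡ n + i → f ≡ n + j →
                      LeftCtx L i j → RightCtx R e f → Bounded i j e (ly L + ry R) 1

  -- The left correction 1 + `ly L′`√2 is multiplied by 1 + √2 and becomes (1 + 2 `ly L′`) + (1 +
  -- `ly L′`)√2. Together with the 1 of the right end, half of the rational part is 1 + `ly L′`,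
  -- whence the last two arguments.
  aligned-bounded : ∀ N {k l n e f} L′ R → pos k < pos l → pos l ≤ suc N + pos k → Agree v (pos k) (pos l) n →
                    e ≡ n + pos k → f ≡ n + pos l → LeftCtx L′ k l → RightCtx R e f →
                    Bounded (pos k) (pos l) e (1 + ly L′ + ry R) (1 + ly L′)
  aligned-bounded N {n = n} L′ R lt le agr e≡ f≡ lc rc
    with k<l , l≤ ← descend-period lt le
       | descent a R′ agr′ rc′ bx by ← right-descent n R agr e≡ f≡ rc =
    lift (agreement-bounded N L′ R′ k<l l≤ agr′ refl refl lc rc′) bx by

  -- Both starts have the same offset in their blocks and the letters before them agree too, so the
  -- agreement is extended to the block starts. There `any` yields a left correction that covers
  -- both values of `L`.
  block-bounded : ∀ N {k l n e f} d L R → d + pos k < d + pos l → d + pos l ≤ suc N + (d + pos k) →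
                  Agree v (pos k) (pos l) d → Agree v (d + pos k) (d + pos l) n →
                  e ≡ n + (d + pos k) → f ≡ n + (d + pos l) → RightCtx R e f →
                  Bounded (d + pos k) (d + pos l) e (ly L + ry R) 1
  block-bounded N {k} {l} d L R lt le agr agr′ e≡ f≡ rc with dx , dy ← count-agree d agr =
    shift-bounded d (+-monoˡ-≤ (ry R) (ly≤1 L)) dx dy
      (aligned-bounded N {k} {l} any R (+-cancelˡ-< d _ _ lt) (+-cancelˡ-≤ d _ _ (≤-trans le (≤-reflexive (+-swap (suc N) d (pos k)))))
        (Agree-join v d agr agr′) (+-reassoc d (pos k) e≡) (+-reassoc d (pos l) f≡) tt rc)

  -- The common first letter is the last 2 of an h(1) and of an h(2). Dropping it leaves an aligned
  -- agreement whose left context is crossed; restoring it takes (2 , 2) off the doubled correction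
  -- (3 , 2) and leaves (1 , 0), the value for `any`.
  cross-bounded : ∀ N {k l i j n e f} L R → i < j → j ≤ suc N + i → Cross (v k) (v l) → v i ≡ 2F →
                  pos (suc k) ≡ suc i → pos (suc l) ≡ suc j →
                  Agree v i j (suc n) → e ≡ suc n + i → f ≡ suc n + j →
                  (∀ {i′ j′} → i ≡ suc i′ → j ≡ suc j′ → ¬ Cross (v i′) (v j′)) →
                  LeftCtx L i j → RightCtx R e f → Bounded i j e (ly L + ry R) 1
  cross-bounded N cross R i<j j≤ c vi ki lj agr e≡ f≡ before (_ , _ , i≡ , j≡ , c′) rc = contradiction c′ (before i≡ j≡)
  cross-bounded N {k} {l} {i} {j} {n} {e} any R i<j j≤ c vi ki lj agr e≡ f≡ before lc rc =
    unshift (subst₂ (λ a b → Bounded a b e (2 + ry R) 2) ki lj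
      (aligned-bounded N {suc k} {suc l} cross R (subst₂ _<_ (sym ki) (sym lj) (s≤s i<j))
        (≤-trans (≤-reflexive lj) (≤-trans (s≤s j≤) (≤-reflexive (trans (sym (+-suc (suc N) i)) (cong (suc N +_) (sym ki))))))
        (subst₂ (λ a b → Agree v a b n) (sym ki) (sym lj) (Agree-drop v 1 agr))
        (trans e≡ (trans (sym (+-suc n i)) (cong (n +_) (sym ki))))
        (trans f≡ (trans (sym (+-suc n j)) (cong (n +_) (sym lj))))
        (k , l , refl , refl , c) rc))
    where
    vj : v j ≡ 2F
    vj = trans (sym (agr 0 (s≤s z≤n))) vi
    unshift : Bounded (suc i) (suc j) e (2 + ry R) 2 → Bounded i j e (ry R) 1
    unshift (bounded {β} {γ} good eqx eqy hx hy) rewrite vi | vj =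
      bounded good (suc-injective eqx) (suc-injective eqy)
        (linear 0 hx (lemmaX (X e) (X i) β)) (linear 0 hy (lemmaY (Y e) (Y i) γ (ry R)))
      where
      lemmaX : ∀ E X β → X + β + (E + 2) ≡ E + 1 + (1 + X + β) + 0
      lemmaX = solve-∀
      lemmaY : ∀ E Y γ r → 2 * Y + γ + (2 * E + (2 + r)) ≡ 2 * E + r + (2 * (1 + Y) + γ) + 0
      lemmaY = solve-∀

  start-agree : ∀ k l → Agree v (pos k) (pos l) 1
  start-agree k l zero    _        = trans (start k) (sym (start l))
  start-agree k l (suc t) (s≤s ())

  twos-agree : ∀ {k l} → v k ≡ 2F → v l ≡ 2F → Agree v (pos k) (pos l) 2
  twos-agree {k} {l} vk vl = Agree-join v 1 (start-agree k l) λ { zero _ → trans (letter 1 vk) (sym (letter 1 vl)) ; (suc t) (s≤s ()) }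

  by-location : ∀ N n {i j e f} L R → Located i → Located j → i < j → j ≤ suc N + i → Agree v i j n →
                e ≡ n + i → f ≡ n + j → LeftCtx L i j → RightCtx R e f → Bounded i j e (ly L + ry R) 1
  by-location N zero L R _ _ i<j j≤ agr refl refl lc rc = empty-bounded L R i<j lc rc
  by-location N (suc n) L R (at0 k) (at0 l) i<j j≤ agr e≡ f≡ lc rc = block-bounded N {k} {l} 0 L R i<j j≤ Agree-empty agr e≡ f≡ rc
  by-location N (suc n) L R (at1 k) (at1 l) i<j j≤ agr e≡ f≡ lc rc = block-bounded N {k} {l} 1 L R i<j j≤ (start-agree k l) agr e≡ f≡ rc
  by-location N (suc n) L R (at2 k vk) (at2 l vl) i<j j≤ agr e≡ f≡ lc rc = block-bounded N {k} {l} 2 L R i<j j≤ (twos-agree vk vl) agr e≡ f≡ rc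
  by-location N (suc n) L R (at0 k) (at1 l) i<j j≤ agr = contradiction (trans (sym (agr 0 (s≤s z≤n))) (start k)) (second-≢0 l)
  by-location N (suc n) L R (at1 k) (at0 l) i<j j≤ agr = contradiction (trans (agr 0 (s≤s z≤n)) (start l)) (second-≢0 k)
  by-location N (suc n) L R (at0 k) (at2 l vl) i<j j≤ agr with () ← trans (sym (start k)) (trans (agr 0 (s≤s z≤n)) (letter 2 vl))
  by-location N (suc n) L R (at2 k vk) (at0 l) i<j j≤ agr with () ← trans (sym (start l)) (trans (sym (agr 0 (s≤s z≤n))) (letter 2 vk))
  by-location N (suc n) L R (at1 k) (at2 l vl) i<j j≤ agr e≡ f≡ lc rc with v k in vk
  ... | 0F with () ← trans (sym (letter 1 vk)) (trans (agr 0 (s≤s z≤n)) (letter 2 vl))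
  ... | 1F = cross-bounded N {k} {l} L R i<j j≤ (inj₁ (vk , vl)) (letter 1 vk) (pos-suc vk) (pos-suc vl) agr e≡ f≡
               (λ { refl _ c → Cross-≢0ˡ c (start k) }) lc rc
  ... | 2F with n
  ...   | suc _ with () ← trans (sym (letter 2 vk)) (trans (agr 1 (s≤s (s≤s z≤n))) (next-start vl))
  ...   | zero with refl ← e≡ | refl ← f≡ = two-bounded L R i<j (letter 1 vk)
               (λ { refl _ c → Cross-≢0ˡ c (start k) }) (λ c → Cross-≢0ʳ c (next-start vl)) lc rc
  by-location N (suc n) L R (at2 k vk) (at1 l) i<j j≤ agr e≡ f≡ lc rc with v l in vl
  ... | 0F with () ← trans (sym (letter 2 vk)) (trans (agr 0 (s≤s z≤n)) (letter 1 vl))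
  ... | 1F = cross-bounded N {k} {l} L R i<j j≤ (inj₂ (vk , vl)) (letter 2 vk) (pos-suc vk) (pos-suc vl) agr e≡ f≡
               (λ { _ refl c → Cross-≢0ʳ c (start l) }) lc rc
  ... | 2F with n
  ...   | suc _ with () ← trans (sym (next-start vk)) (trans (agr 1 (s≤s (s≤s z≤n))) (letter 2 vl))
  ...   | zero with refl ← e≡ | refl ← f≡ = two-bounded L R i<j (letter 2 vk)
               (λ { _ refl c → Cross-≢0ʳ c (start l) }) (λ c → Cross-≢0ˡ c (next-start vk)) lc rc

  agreement-bounded zero    L R i<j j≤ = contradiction i<j (≤⇒≯ j≤)
  agreement-bounded (suc N) {n = n} L R = by-location N n L R (locate _) (locate _)

  -- Extremal agreements along the orbit of the period 1.

  -- An agreement extended maximally on both sides by mismatches x₀ ≠ x₁ and y₀ ≠ y₁, with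
  -- equality in the tight bound.
  record Run (x₀ x₁ y₀ y₁ : Fin 3) (c x y : ℕ) : Set where
    constructor run
    field
      {i j i′ j′} : ℕ
      n       : ℕ
      agree   : Agree v i j n
      i≡      : i ≡ suc i′
      j≡      : j ≡ suc j′
      left₀   : v i′ ≡ x₀
      left₁   : v j′ ≡ x₁
      right₀  : v (n + i) ≡ y₀
      right₁  : v (n + j) ≡ y₁
      periodX : X j ≡ X i + x
      periodY : Y j ≡ Y i + y
      lengthX : X (n + i) + 1 ≡ X i + (x + y)
      lengthY : 2 * Y (n + i) + c ≡ 2 * Y i + (x + 2 * y)

  lengthX-step : ∀ X E Y F x y c → E + 1 ≡ X + (x + y) → 2 * F + c ≡ 2 * Y + (x + 2 * y) →
                 E + 2 * F + (1 + c) ≡ X + 2 * Y + (x + 2 * y + (x + y))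
  lengthX-step X E Y F x y c p q =
    trans (lemma₁ E F c) (trans (cong₂ _+_ p q) (lemma₂ X Y x y))
    where
    lemma₁ : ∀ E F c → E + 2 * F + (1 + c) ≡ E + 1 + (2 * F + c)
    lemma₁ = solve-∀
    lemma₂ : ∀ X Y x y → X + (x + y) + (2 * Y + (x + 2 * y)) ≡ X + 2 * Y + (x + 2 * y + (x + y))
    lemma₂ = solve-∀

  lengthY-step : ∀ X E Y F x y c → E + 1 ≡ X + (x + y) → 2 * F + c ≡ 2 * Y + (x + 2 * y) →
                 2 * (E + F) + (2 + c) ≡ 2 * (X + Y) + (x + 2 * y + 2 * (x + y))
  lengthY-step X E Y F x y c p q =
    trans (lemma₁ E F c) (trans (cong₂ (λ a b → 2 * a + b) p q) (lemma₂ X Y x y))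
    where
    lemma₁ : ∀ E F c → 2 * (E + F) + (2 + c) ≡ 2 * (E + 1) + (2 * F + c)
    lemma₁ = solve-∀
    lemma₂ : ∀ X Y x y → 2 * (X + (x + y)) + (2 * Y + (x + 2 * y)) ≡ 2 * (X + Y) + (x + 2 * y + 2 * (x + y))
    lemma₂ = solve-∀

  -- On the left 022 and 01 already differ in their last letters 2, 1; on the right 01 and 02 share
  -- a 0 and then differ as 1, 2. The values 1 and 3 are `ly` + `ry` for two `any` and for two
  -- `cross` ends.
  run-step₁ : ∀ {x y} → Run 2F 0F 0F 2F 1 x y → Run 2F 1F 1F 2F 3 (x + 2 * y) (x + y)
  run-step₁ {x} {y} (run {i} {j} n agr i≡ j≡ vi vj ve vf px py lx ly)
    with m , agr′ , eqᵢ , eqⱼ ← image-agree hL l0 v v v-image n {i} {j} agr =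
    run (m + 1)
      (Agree-join v m agr′ (subst₂ (λ a b → Agree v a b 1) (sym eqᵢ) (sym eqⱼ) (start-agree (n + i) (n + j))))
      (trans (cong pos i≡) (pos-suc vi)) (trans (cong pos j≡) (pos-suc vj)) (letter 2 vi) (letter 1 vj)
      (trans (cong v (end (pos i) eqᵢ)) (letter 1 ve)) (trans (cong v (end (pos j) eqⱼ)) (letter 1 vf))
      (period-posX {i} {j} px py) (period-posY {i} {j} px py)
      (trans (cong (λ a → X a + 1) (end (pos i) eqᵢ)) (trans (cong (_+ 1) (X-start (n + i)))
        (trans (sym (+-suc _ 1)) (trans (lengthX-step (X i) (X (n + i)) (Y i) (Y (n + i)) x y 1 lx ly) (cong (_+ (x + 2 * y + (x + y))) (sym (X-pos i)))))))
      (trans (cong (λ a → 2 * Y a + 3) (end (pos i) eqᵢ)) (trans (cong (λ a → 2 * a + 3) (Y-start (n + i)))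
        (trans (lengthY-step (X i) (X (n + i)) (Y i) (Y (n + i)) x y 1 lx ly) (cong (λ a → 2 * a + (x + 2 * y + 2 * (x + y))) (sym (Y-pos i))))))
    where
    end : ∀ p {q m} → m + p ≡ q → m + 1 + p ≡ 1 + q
    end p {m = m} refl = cong (_+ p) (+-comm m 1)

  -- On the left 022 and 02 share their last 2 and then differ as 2, 0; on the right 02 followed by
  -- 0 and 022 share 02 and then differ as 0, 2. With one letter gained in front and two behind, the
  -- first shape returns.
  run-step₂ : ∀ {x y} → Run 2F 1F 1F 2F 3 x y → Run 2F 0F 0F 2F 1 (x + 2 * y) (x + y)
  run-step₂ {x} {y} (run {i} {j} {i′} {j′} n agr i≡ j≡ vi vj ve vf px py lx ly)
    with m , agr′ , eqᵢ , eqⱼ ← image-agree hL l0 v v v-image n {i} {j} agr =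
    run {i = 2 + pos i′} {j = 1 + pos j′} (1 + (m + 2))
      (Agree-cons {2 + pos i′} {1 + pos j′} (trans (letter 2 vi) (sym (letter 1 vj)))
        (subst₂ (λ a b → Agree v a b (m + 2)) pi≡ pj≡ (Agree-join v m agr′ (subst₂ (λ a b → Agree v a b 2) (sym eqᵢ) (sym eqⱼ) two))))
      refl refl (letter 1 vi) (start j′)
      (trans (cong v (end eqᵢ pi≡)) (next-start ve)) (trans (cong v (end eqⱼ pj≡)) (letter 2 vf))
      (shift X (X-suc {2 + pos i′} 2F (letter 2 vi)) (X-suc 2F (letter 1 vj)) (period-posX {i} {j} px py))
      (shift Y (Y-suc {2 + pos i′} 2F (letter 2 vi)) (Y-suc 2F (letter 1 vj)) (period-posY {i} {j} px py))
      (suc-injective (begin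
        1 + (X (1 + (m + 2) + (2 + pos i′)) + 1)       ≡⟨ cong (λ a → 1 + (X a + 1)) (end eqᵢ pi≡) ⟩
        1 + (X (2 + pos (n + i)) + 1)                  ≡⟨ cong (λ a → 1 + (a + 1)) (trans (X-suc 2F (letter 1 ve)) (cong (_+ 1) (X-start (n + i)))) ⟩
        1 + (1 + (X (n + i) + 2 * Y (n + i)) + 1 + 1)  ≡⟨ lemmaX (X (n + i)) (Y (n + i)) ⟩
        X (n + i) + 2 * Y (n + i) + 4                  ≡⟨ lengthX-step (X i) (X (n + i)) (Y i) (Y (n + i)) x y 3 lx ly ⟩
        X i + 2 * Y i + W                              ≡⟨ cong (_+ W) (trans (sym (X-pos i)) (trans (cong X pi≡) (X-suc {2 + pos i′} 2F (letter 2 vi)))) ⟩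
        X (2 + pos i′) + 1 + W                         ≡⟨ cong (_+ W) (+-comm (X (2 + pos i′)) 1) ⟩
        1 + (X (2 + pos i′) + W)                       ∎))
      (+-cancelˡ-≡ 2 _ _ (begin
        2 + (2 * Y (1 + (m + 2) + (2 + pos i′)) + 1)   ≡⟨ cong (λ a → 2 + (2 * Y a + 1)) (end eqᵢ pi≡) ⟩
        2 + (2 * Y (2 + pos (n + i)) + 1)              ≡⟨ cong (λ a → 2 + (2 * a + 1)) (trans (Y-suc 2F (letter 1 ve)) (cong (_+ 1) (Y-start (n + i)))) ⟩
        2 + (2 * (X (n + i) + Y (n + i) + 1) + 1)      ≡⟨ lemmaY (X (n + i)) (Y (n + i)) ⟩
        2 * (X (n + i) + Y (n + i)) + 5                ≡⟨ lengthY-step (X i) (X (n + i)) (Y i) (Y (n + i)) x y 3 lx ly ⟩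
        2 * (X i + Y i) + V                            ≡⟨ cong (λ a → 2 * a + V) (trans (sym (Y-pos i)) (trans (cong Y pi≡) (Y-suc {2 + pos i′} 2F (letter 2 vi)))) ⟩
        2 * (Y (2 + pos i′) + 1) + V                   ≡⟨ lemmaV (Y (2 + pos i′)) V ⟩
        2 + (2 * Y (2 + pos i′) + V)                   ∎))
    where
    open ≡-Reasoning
    W = x + 2 * y + (x + y)
    V = x + 2 * y + 2 * (x + y)
    lemmaX : ∀ a b → 1 + (1 + (a + 2 * b) + 1 + 1) ≡ a + 2 * b + 4
    lemmaX = solve-∀
    lemmaY : ∀ a b → 2 + (2 * (a + b + 1) + 1) ≡ 2 * (a + b) + 5
    lemmaY = solve-∀
    lemmaV : ∀ a b → 2 * (a + 1) + b ≡ 2 + (2 * a + b)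
    lemmaV = solve-∀
    pi≡ : pos i ≡ 3 + pos i′
    pi≡ = trans (cong pos i≡) (pos-suc vi)
    pj≡ : pos j ≡ 2 + pos j′
    pj≡ = trans (cong pos j≡) (pos-suc vj)
    two : Agree v (pos (n + i)) (pos (n + j)) 2
    two = Agree-join v 1 (start-agree (n + i) (n + j)) λ { zero _ → trans (letter 1 ve) (sym (letter 1 vf)) ; (suc t) (s≤s ()) }
    end : ∀ {m p q r} → m + p ≡ q → p ≡ suc r → 1 + (m + 2) + r ≡ 2 + q
    end {m} {r = r} refl refl = lemma m r
      where
      lemma : ∀ m r → 1 + (m + 2) + r ≡ 2 + (m + suc r)
      lemma = solve-∀
    shift : ∀ (C : ℕ → ℕ) {w} → C (3 + pos i′) ≡ C (2 + pos i′) + 1 → C (2 + pos j′) ≡ C (1 + pos j′) + 1 →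
            C (pos j) ≡ C (pos i) + w → C (1 + pos j′) ≡ C (2 + pos i′) + w
    shift C {w} ci cj eq = +-cancelʳ-≡ 1 _ _ (begin
      C (1 + pos j′) + 1         ≡⟨ cj ⟨
      C (2 + pos j′)             ≡⟨ cong C pj≡ ⟨
      C (pos j)                  ≡⟨ eq ⟩
      C (pos i) + w              ≡⟨ cong (λ a → C a + w) pi≡ ⟩
      C (3 + pos i′) + w         ≡⟨ cong (_+ w) ci ⟩
      C (2 + pos i′) + 1 + w     ≡⟨ +-assoc (C (2 + pos i′)) 1 w ⟩
      C (2 + pos i′) + (1 + w)   ≡⟨ cong (C (2 + pos i′) +_) (+-comm 1 w) ⟩
      C (2 + pos i′) + (w + 1)   ≡⟨ +-assoc (C (2 + pos i′)) w 1 ⟨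
      C (2 + pos i′) + w + 1     ∎)

  run-double : ∀ {x y} → Run 2F 0F 0F 2F 1 x y → Run 2F 0F 0F 2F 1 (x + 2 * y + 2 * (x + y)) (x + 2 * y + (x + y))
  run-double r = run-step₂ (run-step₁ r)

  -- The factor 202 supplies the start: the empty agreement between its 0 and its last 2, whose
  -- period is the letter 0.
  runs : ∀ {i} → v i ≡ 2F → v (1 + i) ≡ 0F → v (2 + i) ≡ 2F → ∀ N →
         ∃[ x ] ∃[ y ] (N < x × x * x ≡ 1 + 2 * (y * y) × Run 2F 0F 0F 2F 1 x y)
  runs {i} v₀ v₁ v₂ zero = 1 , 0 , s≤s z≤n , refl ,
    run {i = 1 + i} {2 + i} {i} {1 + i} 0 Agree-empty refl refl v₀ v₁ v₁ v₂ (X-suc 0F v₁) (Y-suc 0F v₁) refl refl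
  runs {i} v₀ v₁ v₂ (suc N) with x , y , N<x , norm , r ← runs v₀ v₁ v₂ N =
    _ , _ , linear (x + 4 * y + pred x) N<x (lemma N x y N<x) , norm⁻-step (x + 2 * y) (x + y) (norm⁺-step x y norm) , run-double r
    where
    lemma : ∀ N x y → N < x → x + 2 * y + 2 * (x + y) + suc N ≡ suc (suc N) + x + (x + 4 * y + pred x)
    lemma N (suc x) y _ = lemma′ N x y
      where
      lemma′ : ∀ N x y → suc x + 2 * y + 2 * (suc x + y) + suc N ≡ suc (suc N) + suc x + (suc x + 4 * y + x)
      lemma′ = solve-∀

-- Agreements in the image under f ∘ g

module Binary (v : ℕ → Fin 3) (v-image : IsImage hL l0 v v) (w : ℕ → Fin 2) (w-image : IsImage fg b0 v w) where
  open Ternary v v-image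

  posᵘ : ℕ → ℕ
  posᵘ = offset fg v

  posᵘ-count : ∀ k → posᵘ k ≡ 5 * X k + 8 * Y k
  posᵘ-count zero    = refl
  posᵘ-count (suc k) = trans (cong₂ _+_ (fg-length (v k)) (posᵘ-count k)) (lemma (wx (v k)) (wy (v k)) (X k) (Y k))
    where
    lemma : ∀ a b x y → 5 * a + 8 * b + (5 * x + 8 * y) ≡ 5 * (a + x) + 8 * (b + y)
    lemma = solve-∀

  period-posᵘ : ∀ {k l x y} → X l ≡ X k + x → Y l ≡ Y k + y → posᵘ l ≡ posᵘ k + (5 * x + 8 * y)
  period-posᵘ {k} {l} {x} {y} eqx eqy = trans (posᵘ-count l) (trans (cong₂ (λ a b → 5 * a + 8 * b) eqx eqy)
    (trans (lemma (X k) (Y k) x y) (cong (_+ (5 * x + 8 * y)) (sym (posᵘ-count k)))))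
    where
    lemma : ∀ X Y x y → 5 * (X + x) + 8 * (Y + y) ≡ 5 * X + 8 * Y + (5 * x + 8 * y)
    lemma = solve-∀

  posᵘ-suc : ∀ {k x} → v k ≡ x → posᵘ (suc k) ≡ length (fg x) + posᵘ k
  posᵘ-suc {k} eq = cong (λ x → length (fg x) + posᵘ k) eq

  letterᵘ : ∀ d {k x} {d< : True (d <? length (fg x))} → v k ≡ x → w (d + posᵘ k) ≡ nth b0 (fg x) d
  letterᵘ d {k} {d< = d<} refl = w-image k d (toWitness d<)

  startᵘ : ∀ k → w (posᵘ k) ≡ 0F × w (1 + posᵘ k) ≡ 0F
  startᵘ k with v k in eq
  ... | 0F = letterᵘ 0 eq , letterᵘ 1 eq
  ... | 1F = letterᵘ 0 eq , letterᵘ 1 eq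
  ... | 2F = letterᵘ 0 eq , letterᵘ 1 eq

  next-startᵘ : ∀ {k x} → v k ≡ x → w (length (fg x) + posᵘ k) ≡ 0F × w (1 + (length (fg x) + posᵘ k)) ≡ 0F
  next-startᵘ {k} eq = subst (λ n → w n ≡ 0F × w (1 + n) ≡ 0F) (posᵘ-suc eq) (startᵘ (suc k))

  locateᵘ : ∀ n → ∃[ k ] ∃[ d ] (d < length (fg (v k)) × n ≡ d + posᵘ k)
  locateᵘ zero    = 0 , 0 , ≤-trans (s≤s z≤n) (fg-long (v 0)) , refl
  locateᵘ (suc n) with k , d , d< , refl ← locateᵘ n with suc d <? length (fg (v k))
  ... | yes d<′ = k , suc d , d<′ , refl
  ... | no  d≮ = suc k , 0 , ≤-trans (s≤s z≤n) (fg-long (v (suc k))) , cong (_+ posᵘ k) (≤-antisym d< (≮⇒≥ d≮))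

  00⇒start : ∀ {n} → w n ≡ 0F → w (1 + n) ≡ 0F → ∃[ k ] n ≡ posᵘ k
  00⇒start {n} eq eq′ with k , d , d< , refl ← locateᵘ n
    with d<′ , zero? ← block-start? (v k) d< (trans (sym (w-image k d d<)) eq)
    with refl ← zero? (trans (sym (w-image k (suc d) d<′)) eq′) = k , refl

  window : ℕ → ℕ → List (Fin 2)
  window zero    k = []
  window (suc m) k = fg (v k) ++ window m (suc k)

  window-nth : ∀ m k {t} → t < length (window m k) → w (t + posᵘ k) ≡ nth b0 (window m k) t
  window-nth (suc m) k {t} t< with t <? length (fg (v k))
  ... | yes t<′ = trans (w-image k t t<′) (sym (nth-++ˡ b0 (fg (v k)) _ t<′))
  ... | no  t≮ with r , refl ← ≤⇒∃+ (≮⇒≥ t≮) = begin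
    w (r + length (fg (v k)) + posᵘ k)                               ≡⟨ cong w (+-assoc r _ _) ⟩
    w (r + posᵘ (suc k))                                             ≡⟨ window-nth m (suc k) (+-cancelʳ-< (length (fg (v k))) _ _ r<) ⟩
    nth b0 (window m (suc k)) r                                      ≡⟨ nth-++ʳ b0 (fg (v k)) _ r ⟨
    nth b0 (fg (v k) ++ window m (suc k)) (r + length (fg (v k)))    ∎
    where
    open ≡-Reasoning
    r< : r + length (fg (v k)) < length (window m (suc k)) + length (fg (v k))
    r< = ≤-trans t< (≤-reflexive (trans (length-++ (fg (v k))) (+-comm (length (fg (v k))) _)))

  apart : ∀ k → Apart (v k) (v (suc k))
  apart k (eq , eq′) = no-00 k eq eq′

  short-period : ∀ {i p} → p < 7 → ¬ Agree w i (suc p + i) (suc (17 * suc p / 10))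
  short-period {i} {p} p< agr with k , d , d< , refl ← locateᵘ i
    with n , n< , end< , ≢ ← short-mismatch (v k) (v (1 + k)) (v (2 + k)) (v (3 + k)) (apart _) (apart _) (apart _) d< p< =
    ≢ (begin
      nth b0 (window 4 k) (n + d)               ≡⟨ window-nth 4 k (≤-trans (s≤s (+-monoʳ-≤ n (m≤n+m d (suc p)))) end<) ⟨
      w (n + d + posᵘ k)                        ≡⟨ cong w (+-assoc n d _) ⟩
      w (n + (d + posᵘ k))                      ≡⟨ agr n n< ⟩
      w (n + (suc p + (d + posᵘ k)))            ≡⟨ cong w (lemma n (suc p) d (posᵘ k)) ⟩
      w (n + (suc p + d) + posᵘ k)              ≡⟨ window-nth 4 k end< ⟩
      nth b0 (window 4 k) (n + (suc p + d))     ∎)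
    where
    open ≡-Reasoning
    lemma : ∀ n p d q → n + (p + (d + q)) ≡ n + (p + d) + q
    lemma = solve-∀

  -- Desubstitution from `u` to `v`.

  record RightDescentᵘ (k l e : ℕ) : Set where
    constructor descentᵘ
    field
      length′ : ℕ
      flag    : Flag
      agree   : Agree v k l length′
      ctx     : RightCtx flag (length′ + k) (length′ + l)
      bound   : e ≤ posᵘ (length′ + k) + (1 + 4 * ry flag)

  RightDescentᵘ-cons : ∀ {k l e} → v k ≡ v l → RightDescentᵘ (suc k) (suc l) e → RightDescentᵘ k l e
  RightDescentᵘ-cons {k} {l} eq (descentᵘ n F agr ctx b)
    rewrite +-suc n k | +-suc n l = descentᵘ (suc n) F (Agree-cons eq agr) ctx b

  stopᵘ : ∀ {k l} n F → RightCtx F k l → n ≤ 1 + 4 * ry F → RightDescentᵘ k l (n + posᵘ k)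
  stopᵘ {k} n F c n≤ = descentᵘ 0 F Agree-empty c (≤-trans (+-monoˡ-≤ (posᵘ k) n≤) (≤-reflexive (+-comm _ (posᵘ k))))

  -- The blocks fg 0 and fg 1 (or fg 2), followed by further blocks, share a prefix of length
  -- exactly 5, and fg 1 and fg 2 one of length 9; the common suffixes in left-subcritical have
  -- lengths 3 and 7.
  right-descentᵘ : ∀ N n {k l} → n ≤ N → Agree w (posᵘ k) (posᵘ l) n → RightDescentᵘ k l (n + posᵘ k)
  right-descentᵘ N n {k} {l} n≤ agr with n ≤? 5
  ... | yes n≤5 = stopᵘ n any tt n≤5
  right-descentᵘ zero    n n≤ agr | no n≰5 = contradiction (≤-trans n≤ z≤n) n≰5
  right-descentᵘ (suc N) n {k} {l} n≤ agr | no n≰5 = by-letters (v k) (v l) refl refl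
    where
    6th : w (5 + posᵘ k) ≡ w (5 + posᵘ l)
    6th = agr 5 (≰⇒> n≰5)

    same : ∀ x → v k ≡ x → v l ≡ x → RightDescentᵘ k l (n + posᵘ k)
    same x vk vl with length (fg x) ≤? n
    ... | no  n< = descentᵘ 1 any (Agree-cons (trans vk (sym vl)) Agree-empty) tt
      (≤-trans (≤-trans (+-monoˡ-≤ (posᵘ k) (≰⇒≥ n<)) (≤-reflexive (sym (posᵘ-suc vk)))) (m≤m+n _ 5))
    ... | yes ≤n with r , refl ← ≤⇒∃+ ≤n = RightDescentᵘ-cons (trans vk (sym vl))
      (subst (RightDescentᵘ (suc k) (suc l)) (trans (cong (r +_) (posᵘ-suc vk)) (sym (+-assoc r _ _)))
        (right-descentᵘ N r (≤-pred (≤-trans (m<m+n r (≤-trans (s≤s z≤n) (fg-long x))) n≤))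
          (subst₂ (λ a b → Agree w a b r) (sym (posᵘ-suc vk)) (sym (posᵘ-suc vl))
            (Agree-drop w (length (fg x)) (subst (Agree w (posᵘ k) (posᵘ l)) (+-comm r _) agr)))))

    mixed : Cross (v k) (v l) → RightDescentᵘ k l (n + posᵘ k)
    mixed c with n ≤? 9
    ... | yes n≤9 = stopᵘ n cross c n≤9
    mixed (inj₁ (vk , vl)) | no n≰9
      with () ← trans (sym (proj₂ (next-startᵘ vk))) (trans (agr 9 (≰⇒> n≰9)) (letterᵘ 9 vl))
    mixed (inj₂ (vk , vl)) | no n≰9
      with () ← trans (sym (proj₂ (next-startᵘ vl))) (trans (sym (agr 9 (≰⇒> n≰9))) (letterᵘ 9 vk))

    by-letters : ∀ x y → v k ≡ x → v l ≡ y → RightDescentᵘ k l (n + posᵘ k)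
    by-letters 0F 0F vk vl = same 0F vk vl
    by-letters 1F 1F vk vl = same 1F vk vl
    by-letters 2F 2F vk vl = same 2F vk vl
    by-letters 1F 2F vk vl = mixed (inj₁ (vk , vl))
    by-letters 2F 1F vk vl = mixed (inj₂ (vk , vl))
    by-letters 0F 1F vk vl with () ← trans (sym (proj₁ (next-startᵘ vk))) (trans 6th (letterᵘ 5 vl))
    by-letters 0F 2F vk vl with () ← trans (sym (proj₁ (next-startᵘ vk))) (trans 6th (letterᵘ 5 vl))
    by-letters 1F 0F vk vl with () ← trans (sym (letterᵘ 5 vk)) (trans 6th (proj₁ (next-startᵘ vl)))
    by-letters 2F 0F vk vl with () ← trans (sym (letterᵘ 5 vk)) (trans 6th (proj₁ (next-startᵘ vl)))

  -- For e = a - p this says a/p < 1 + √2/2. Quantifying over `e` avoids truncated subtraction and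
  -- makes the case a < p vacuous.
  Subcritical : ℕ → ℕ → Set
  Subcritical p a = ∀ e → p + e ≤ a → 2 * (e * e) < p * p

  -- The overlaps 3 + 4 `ly L` and 1 + 4 `ry F` add up to one less than 5 + 4(`ly L` + `ry F`), the
  -- value of 5x + 8y on the correction in `v`. Hence the corrected bound becomes `suc a` ≤ 5β + 4γ.
  aligned-subcritical : ∀ {k l n p} a L → 1 ≤ p → posᵘ l ≡ p + posᵘ k → Agree w (posᵘ k) (posᵘ l) n → LeftCtx L k l →
                        a ≤ n + (3 + 4 * ly L) → Subcritical p a
  aligned-subcritical {k} {l} {n} {p} a L 1≤p l≡ agr lc a≤ e e≤
    with descentᵘ b F agr′ rc bound ← right-descentᵘ n n ≤-refl agr =
    finish (agreement-bounded l L F (offset-cancel-< fg fg-long v (subst (posᵘ k <_) (sym l≡) (m<n+m (posᵘ k) 1≤p)))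
             (m≤m+n l k) agr′ refl refl lc rc)
    where
    finish : Bounded k l (b + k) (ly L + ry F) 1 → 2 * (e * e) < p * p
    finish (bounded {β} {γ} {x} {y} good eqx eqy hx hy) =
      subst (λ p → 2 * (e * e) < p * p) (sym p≡) (Good⇒subcritical good {a} {e} a< (subst (λ p → p + e ≤ a) p≡ e≤))
      where
      p≡ : p ≡ 5 * x + 8 * y
      p≡ = +-cancelʳ-≡ (posᵘ k) p _ (trans (sym l≡) (trans (period-posᵘ {k} {l} eqx eqy) (+-comm (posᵘ k) _)))
      n≤ : n + (5 * X k + 8 * Y k) ≤ 5 * X (b + k) + 8 * Y (b + k) + (1 + 4 * ry F)
      n≤ = subst₂ (λ p q → n + p ≤ q + (1 + 4 * ry F)) (posᵘ-count k) (posᵘ-count (b + k)) bound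
      a< : suc a ≤ 5 * β + 4 * γ
      a< = linear 0 (+-mono-≤ (+-mono-≤ a≤ n≤) (+-mono-≤ (*-monoʳ-≤ 5 hx) (*-monoʳ-≤ 4 hy)))
        (lemma a n (X k) (Y k) (X (b + k)) (Y (b + k)) (ly L) (ry F) β γ)
        where
        lemma : ∀ a n X Y x y L R β γ →
          5 * β + 4 * γ + (a + (n + (5 * X + 8 * Y)) + (5 * (x + 1) + 4 * (2 * y + (L + R))))
          ≡ suc a + (n + (3 + 4 * L) + (5 * x + 8 * y + (1 + 4 * R)) + (5 * (X + β) + 4 * (2 * Y + γ))) + 0
        lemma = solve-∀

  back : ∀ c m {k i t x} → v k ≡ x → length (fg x) ≡ c + m → c + t + i ≡ posᵘ (suc k) → t + i ≡ m + posᵘ k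
  back c m {k} {i} {t} vk len eq = +-cancelˡ-≡ c _ _ (begin
    c + (t + i)          ≡⟨ +-assoc c t i ⟨
    c + t + i            ≡⟨ eq ⟩
    posᵘ (suc k)         ≡⟨ posᵘ-suc vk ⟩
    _ + posᵘ k           ≡⟨ cong (_+ posᵘ k) len ⟩
    c + m + posᵘ k       ≡⟨ +-assoc c m _ ⟩
    c + (m + posᵘ k)     ∎)
    where open ≡-Reasoning

  -- If the blocks ending where `k` and `l` start come from the same letter, completing them to the
  -- left only lengthens the agreement. Otherwise their common suffix bounds `t` and supplies the
  -- left flag; `within` keeps the `t` letters inside one block.
  left-subcritical : ∀ {i p n k l} t → 1 ≤ p → t + i ≡ posᵘ k → t + (p + i) ≡ posᵘ l → Agree w i (p + i) (t + n) →
                     (∀ {k′} → k ≡ suc k′ → t ≤ length (fg (v k′))) → Subcritical p (t + n)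
  left-subcritical {i} {p} {n} {k} {l} t 1≤p tk tl agr within = by-length (t ≤? 3)
    where
    l≡ : posᵘ l ≡ p + posᵘ k
    l≡ = trans (sym tl) (trans (+-swap t p i) (cong (p +_) tk))

    agr′ : Agree w (posᵘ k) (posᵘ l) n
    agr′ = subst₂ (λ a b → Agree w a b n) tk tl (Agree-drop w t agr)

    from-start : ∀ L → LeftCtx L k l → t ≤ 3 + 4 * ly L → Subcritical p (t + n)
    from-start L lc t≤ = aligned-subcritical (t + n) L 1≤p l≡ agr′ lc (≤-trans (+-monoˡ-≤ n t≤) (≤-reflexive (+-comm _ n)))

    same : ∀ {k′ l′} → k ≡ suc k′ → l ≡ suc l′ → v k′ ≡ v l′ → Subcritical p (t + n)
    same {k′} {l′} refl refl eq with d , len ← ≤⇒∃+ (within refl) =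
      aligned-subcritical {k′} {l′} (t + n) any 1≤p
        (+-cancelˡ-≡ d _ _ (trans (sym j≡) (trans (cong (p +_) i≡) (+-swap p d _))))
        (Agree-join w d (Agree-shorten w (≤-trans (m≤m+n d t) (≤-reflexive (sym len))) (block-agree fg b0 v w w-image eq))
          (subst₂ (λ a b → Agree w a b (t + n)) i≡ j≡ agr))
        tt (≤-trans (m≤n+m (t + n) d) (m≤m+n _ 3))
      where
      i≡ : i ≡ d + posᵘ k′
      i≡ = back t d {t = 0} refl (trans len (+-comm d t)) (trans (cong (_+ i) (+-identityʳ t)) tk)
      j≡ : p + i ≡ d + posᵘ l′
      j≡ = back t d {t = 0} (sym eq) (trans len (+-comm d t)) (trans (cong (_+ (p + i)) (+-identityʳ t)) tl)

    far : ∀ {t′ k′ l′} → t ≡ 4 + t′ → k ≡ suc k′ → l ≡ suc l′ → Subcritical p (t + n)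
    far {t′} {k′} {l′} refl refl refl = by-letters (v k′) (v l′) refl refl
      where
      letters-at : ∀ c m m′ {t″ x y} → t ≡ c + t″ → 1 ≤ c → v k′ ≡ x → v l′ ≡ y → length (fg x) ≡ c + m → length (fg y) ≡ c + m′ →
                   w (m + posᵘ k′) ≡ w (m′ + posᵘ l′)
      letters-at c m m′ {t″} t≡ 1≤c vk vl lenx leny = subst₂ (λ a b → w a ≡ w b)
        (back c m vk lenx (trans (cong (_+ i) (sym t≡)) tk)) (back c m′ vl leny (trans (cong (_+ (p + i)) (sym t≡)) tl))
        (agr t″ (≤-trans (+-monoˡ-≤ t″ 1≤c) (≤-trans (≤-reflexive (sym t≡)) (m≤m+n t n))))

      mixed : Cross (v k′) (v l′) → Subcritical p (t + n)
      mixed c with t ≤? 7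
      ... | yes t≤7 = from-start cross (k′ , l′ , refl , refl , c) t≤7
      mixed (inj₁ (vk , vl)) | no t≰7 with r , eq ← ≤⇒∃+ (≰⇒> t≰7)
        with () ← trans (sym (letterᵘ 0 vk)) (trans (letters-at 8 0 5 (trans eq (+-comm r 8)) (s≤s z≤n) vk vl refl refl) (letterᵘ 5 vl))
      mixed (inj₂ (vk , vl)) | no t≰7 with r , eq ← ≤⇒∃+ (≰⇒> t≰7)
        with () ← trans (sym (letterᵘ 5 vk)) (trans (letters-at 8 5 0 (trans eq (+-comm r 8)) (s≤s z≤n) vk vl refl refl) (letterᵘ 0 vl))

      by-letters : ∀ x y → v k′ ≡ x → v l′ ≡ y → Subcritical p (t + n)
      by-letters 0F 0F vk vl = same refl refl (trans vk (sym vl))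
      by-letters 1F 1F vk vl = same refl refl (trans vk (sym vl))
      by-letters 2F 2F vk vl = same refl refl (trans vk (sym vl))
      by-letters 1F 2F vk vl = mixed (inj₁ (vk , vl))
      by-letters 2F 1F vk vl = mixed (inj₂ (vk , vl))
      by-letters 0F 1F vk vl with () ← trans (sym (letterᵘ 1 vk)) (trans (letters-at 4 1 4 refl (s≤s z≤n) vk vl refl refl) (letterᵘ 4 vl))
      by-letters 0F 2F vk vl with () ← trans (sym (letterᵘ 1 vk)) (trans (letters-at 4 1 9 refl (s≤s z≤n) vk vl refl refl) (letterᵘ 9 vl))
      by-letters 1F 0F vk vl with () ← trans (sym (letterᵘ 4 vk)) (trans (letters-at 4 4 1 refl (s≤s z≤n) vk vl refl refl) (letterᵘ 1 vl))
      by-letters 2F 0F vk vl with () ← trans (sym (letterᵘ 9 vk)) (trans (letters-at 4 9 1 refl (s≤s z≤n) vk vl refl refl) (letterᵘ 1 vl))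

    block-before : ∀ {r m k} → t ≡ r + 4 → t + m ≡ posᵘ k → ∃[ k′ ] k ≡ suc k′
    block-before {k = suc k} _ _ = k , refl
    block-before {r} {k = zero} refl eq = contradiction (m+n≡0⇒m≡0 t eq) (λ eq′ → contradiction (m+n≡0⇒n≡0 r eq′) λ ())

    by-length : Dec (t ≤ 3) → Subcritical p (t + n)
    by-length (yes t≤3) = from-start any tt t≤3
    by-length (no t≰3) with r , eq ← ≤⇒∃+ (≰⇒> t≰3)
      with _ , k≡ ← block-before eq tk | _ , l≡ ← block-before eq tl = far (trans eq (+-comm r 4)) k≡ l≡

  next-block : ∀ i → ∃[ k ] ∃[ t ] (t ≤ 12 × t + i ≡ posᵘ k × (∀ {k′} → k ≡ suc k′ → t ≤ length (fg (v k′))))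
  next-block i with locateᵘ i
  ... | k , zero , d< , refl = k , 0 , z≤n , refl , λ _ → z≤n
  ... | k , suc d , d< , refl with t , len ← ≤⇒∃+ (<⇒≤ d<) =
    suc k , t ,
    ≤-pred (≤-trans (m<m+n t (s≤s z≤n)) (≤-trans (≤-reflexive (sym len)) (fg-short (v k)))) ,
    trans (sym (+-assoc t (suc d) (posᵘ k))) (cong (_+ posᵘ k) (sym len)) ,
    λ { refl → ≤-trans (m≤m+n t _) (≤-reflexive (sym len)) }

  -- The next block start is at most 12 letters ahead, so 14 letters contain its 00. The other copy
  -- shows the same 00 and thus a block start at the same distance.
  long-subcritical : ∀ {i p a} → 1 ≤ p → 14 ≤ a → Agree w i (p + i) a → Subcritical p a
  long-subcritical {i} {p} {a} 1≤p a≥ agr with k , t , t≤ , tk , within ← next-block i = go (≤⇒∃+ t+1<)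
    where
    00ᵢ : w (t + i) ≡ 0F × w (1 + (t + i)) ≡ 0F
    00ᵢ = subst (λ n → w n ≡ 0F × w (1 + n) ≡ 0F) (sym tk) (startᵘ k)
    t+1< : 1 + t < a
    t+1< = ≤-trans (s≤s (s≤s t≤)) a≥
    start-ahead : ∃[ l ] t + (p + i) ≡ posᵘ l
    start-ahead = 00⇒start (trans (sym (agr t (≤-trans (n≤1+n _) t+1<))) (proj₁ 00ᵢ))
                           (trans (sym (agr (1 + t) t+1<)) (proj₂ 00ᵢ))
    go : ∃[ r ] a ≡ r + (2 + t) → Subcritical p a
    go (r , eq) = subst (Subcritical p) (sym a≡)
      (left-subcritical {n = 2 + r} {l = proj₁ start-ahead} t 1≤p tk (proj₂ start-ahead) (subst (Agree w i (p + i)) a≡ agr) within)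
      where
      a≡ : a ≡ t + (2 + r)
      a≡ = trans eq (lemma r t)
        where
        lemma : ∀ r t → r + (2 + t) ≡ t + (2 + r)
        lemma = solve-∀

  -- Periods from 8 on respect the ratio 17/10 by themselves, because 10 · 13 ≤ 17 · 8; the finite
  -- check covers the smaller ones.
  small-subcritical : ∀ {i a} p → Agree w i (suc p + i) a → a ≤ 13 → Dec (10 * a ≤ 17 * suc p) → Dec (p < 7) → Subcritical (suc p) a
  small-subcritical {a = a} p agr a≤ (yes h) _ = λ e → ratio⇒subcritical (suc p) a e (s≤s z≤n) h
  small-subcritical {i} {a} p agr a≤ (no h) (yes p<7) =
    contradiction (Agree-shorten w (m<n*o⇒m/o<n {17 * suc p} {a} {10} (≤-trans (≰⇒> h) (≤-reflexive (*-comm 10 a)))) agr) (short-period p<7)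
  small-subcritical {a = a} p agr a≤ (no h) (no p≮7) =
    contradiction (≤-trans (*-monoʳ-≤ 10 a≤) (≤-trans (m≤m+n 130 6) (*-monoʳ-≤ 17 (s≤s (≮⇒≥ p≮7))))) h

  subcritical : ∀ {i p a} → 1 ≤ p → Agree w i (p + i) a → Subcritical p a
  subcritical {i} {suc p} {a} 1≤p agr = by-length (a ≤? 13)
    where
    by-length : Dec (a ≤ 13) → Subcritical (suc p) a
    by-length (yes a≤) = small-subcritical p agr a≤ (10 * a ≤? 17 * suc p) (p <? 7)
    by-length (no a≰) = long-subcritical 1≤p (≰⇒> a≰) agr

  -- The two bounds for the exponent.

  run-image : ∀ {x y} → Run 2F 0F 0F 2F 1 x y →
    ∃[ i ] ∃[ a ] (Agree w i (5 * x + 8 * y + i) a × a + 1 ≡ 9 * x + 13 * y)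
  run-image {x} {y} (run {i} {j} {i′} {j′} n agr i≡ j≡ vi vj ve vf px py lx ly)
    with m , agr′ , eqᵢ , eqⱼ ← image-agree fg b0 v w w-image n {i} {j} agr =
    -- On the left the blocks of 2 and 0 share the suffix 101, which starts at index 10 of the one
    -- and 2 of the other; on the right the blocks of 0 and 2 share 00101.
    10 + posᵘ i′ , 3 + (m + 5) ,
    subst (λ a → Agree w (10 + posᵘ i′) a (3 + (m + 5))) shifted
      (Agree-join w 3 before (subst₂ (λ a b → Agree w a b (m + 5)) pi≡ pj≡
        (Agree-join w m agr′ (subst₂ (λ a b → Agree w a b 5) (sym eqᵢ) (sym eqⱼ) after)))) ,
    +-cancelʳ-≡ (5 * X i + 8 * Y i) _ _ (begin
      3 + (m + 5) + 1 + (5 * X i + 8 * Y i)             ≡⟨ cong (3 + (m + 5) + 1 +_) (posᵘ-count i) ⟨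
      3 + (m + 5) + 1 + posᵘ i                          ≡⟨ lemma₁ m (posᵘ i) ⟩
      m + posᵘ i + 9                                    ≡⟨ cong (_+ 9) (trans eqᵢ (posᵘ-count (n + i))) ⟩
      5 * X (n + i) + 8 * Y (n + i) + 9                 ≡⟨ lemma₂ (X (n + i)) (Y (n + i)) ⟩
      5 * (X (n + i) + 1) + 4 * (2 * Y (n + i) + 1)     ≡⟨ cong₂ (λ a b → 5 * a + 4 * b) lx ly ⟩
      5 * (X i + (x + y)) + 4 * (2 * Y i + (x + 2 * y)) ≡⟨ lemma₃ (X i) (Y i) x y ⟩
      9 * x + 13 * y + (5 * X i + 8 * Y i)              ∎)
    where
    open ≡-Reasoning
    lemma₁ : ∀ m p → 3 + (m + 5) + 1 + p ≡ m + p + 9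
    lemma₁ = solve-∀
    lemma₂ : ∀ X Y → 5 * X + 8 * Y + 9 ≡ 5 * (X + 1) + 4 * (2 * Y + 1)
    lemma₂ = solve-∀
    lemma₃ : ∀ X Y x y → 5 * (X + (x + y)) + 4 * (2 * Y + (x + 2 * y)) ≡ 9 * x + 13 * y + (5 * X + 8 * Y)
    lemma₃ = solve-∀
    pi≡ : posᵘ i ≡ 13 + posᵘ i′
    pi≡ = trans (cong posᵘ i≡) (posᵘ-suc vi)
    pj≡ : posᵘ j ≡ 5 + posᵘ j′
    pj≡ = trans (cong posᵘ j≡) (posᵘ-suc vj)
    shifted : 2 + posᵘ j′ ≡ 5 * x + 8 * y + (10 + posᵘ i′)
    shifted = +-cancelˡ-≡ 3 _ _ (begin
      5 + posᵘ j′                                ≡⟨ pj≡ ⟨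
      posᵘ j                                     ≡⟨ period-posᵘ {i} {j} px py ⟩
      posᵘ i + (5 * x + 8 * y)                   ≡⟨ cong (_+ (5 * x + 8 * y)) pi≡ ⟩
      13 + posᵘ i′ + (5 * x + 8 * y)             ≡⟨ lemma (posᵘ i′) (5 * x + 8 * y) ⟩
      3 + (5 * x + 8 * y + (10 + posᵘ i′))       ∎)
      where
      lemma : ∀ p q → 13 + p + q ≡ 3 + (q + (10 + p))
      lemma = solve-∀
    before : Agree w (10 + posᵘ i′) (2 + posᵘ j′) 3
    before 0 _ = trans (letterᵘ 10 vi) (sym (letterᵘ 2 vj))
    before 1 _ = trans (letterᵘ 11 vi) (sym (letterᵘ 3 vj))
    before 2 _ = trans (letterᵘ 12 vi) (sym (letterᵘ 4 vj))
    before (suc (suc (suc _))) (s≤s (s≤s (s≤s ())))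
    after : Agree w (posᵘ (n + i)) (posᵘ (n + j)) 5
    after 0 _ = trans (letterᵘ 0 ve) (sym (letterᵘ 0 vf))
    after 1 _ = trans (letterᵘ 1 ve) (sym (letterᵘ 1 vf))
    after 2 _ = trans (letterᵘ 2 ve) (sym (letterᵘ 2 vf))
    after 3 _ = trans (letterᵘ 3 ve) (sym (letterᵘ 3 vf))
    after 4 _ = trans (letterᵘ 4 ve) (sym (letterᵘ 4 vf))
    after (suc (suc (suc (suc (suc _))))) (s≤s (s≤s (s≤s (s≤s (s≤s ())))))

  below⇒power : ∀ {i} → v i ≡ 2F → v (1 + i) ≡ 0F → v (2 + i) ≡ 2F →
                ∀ a b q → 2 * a ≤ 4 * b + q → q * q < 2 * (b * b) → ContainsPower w a b
  below⇒power v₀ v₁ v₂ a b q a≤ q² = from-run (runs v₀ v₁ v₂ (4 * (b * q)))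
    where
    lemma : ∀ x y → 2 * (9 * x + 13 * y) ≡ 2 * (5 * x + 8 * y) + (8 * x + 10 * y)
    lemma = solve-∀
    from-image : ∀ x y → 4 * (b * q) < x → x * x ≡ 1 + 2 * (y * y) →
                 ∃[ i ] ∃[ c ] (Agree w i (5 * x + 8 * y + i) c × c + 1 ≡ 9 * x + 13 * y) → ContainsPower w a b
    from-image x y x> norm (i , c , agr , c≡) = agree⇒power w a b
      (≤-trans (≤-trans (s≤s z≤n) x>) (≤-trans (m≤n*m x 5) (m≤m+n (5 * x) (8 * y)))) agr
      (power-ratio a b q (5 * x + 8 * y) (8 * x + 10 * y) c a≤ (ratio-approached b q x y q² (<⇒≤ x>) norm)
        (trans (cong (2 *_) c≡) (lemma x y)))
    from-run : _ → ContainsPower w a b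
    from-run (x , y , x> , norm , r) = from-image x y x> norm (run-image r)

  -- A power of length m = 2p + e is an agreement of length p + e, and the exponent condition
  -- becomes qp ≤ 2be. Squaring and using 2b² < q² contradicts 2e² < p².
  above⇒no-power : ∀ a b q → 1 ≤ b → 4 * b + q ≤ 2 * a → 2 * (b * b) < q * q → ¬ ContainsPower w a b
  above⇒no-power a b@(suc _) q 1≤b a≥ q² (i , m , p , 1≤m , 1≤p , periodic , ap≤) = excess (≤⇒∃+ 2p≤m)
    where
    hyp : (4 * b + q) * p ≤ 2 * (m * b)
    hyp = ≤-trans (*-monoˡ-≤ p a≥) (≤-trans (≤-reflexive (*-assoc 2 a p)) (*-monoʳ-≤ 2 ap≤))
    2p≤m : 2 * p ≤ m
    2p≤m = *-cancelˡ-≤ {2 * p} {m} (2 * b) (linear (q * p) hyp (lemma b q p m))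
      where
      lemma : ∀ b q p m → 2 * b * m + (4 * b + q) * p ≡ 2 * b * (2 * p) + 2 * (m * b) + q * p
      lemma = solve-∀
    excess : ∃[ e ] m ≡ e + 2 * p → ⊥
    excess (e , refl) = <-irrefl refl (begin-strict
      2 * (b * b) * (p * p)           <⟨ *-monoˡ-< (p * p) {{>-nonZero (*-mono-≤ 1≤p 1≤p)}} q² ⟩
      q * q * (p * p)                 ≡⟨ lemma₁ q p ⟩
      q * p * (q * p)                 ≤⟨ *-mono-≤ qp≤ qp≤ ⟩
      2 * b * e * (2 * b * e)         ≡⟨ lemma₂ b e ⟩
      2 * (b * b) * (2 * (e * e))     ≤⟨ *-monoʳ-≤ (2 * (b * b)) (<⇒≤ (subcritical 1≤p agr e ≤-refl)) ⟩
      2 * (b * b) * (p * p)           ∎)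
      where
      open ≤-Reasoning
      agr : Agree w i (p + i) (p + e)
      agr t t< = subst₂ (λ m n → w m ≡ w n) (+-comm i t) (lemma i t p)
        (periodic t (≤-trans (+-monoˡ-< p t<) (≤-reflexive (lemma′ p e))))
        where
        lemma : ∀ i t p → i + t + p ≡ t + (p + i)
        lemma = solve-∀
        lemma′ : ∀ p e → p + e + p ≡ e + 2 * p
        lemma′ = solve-∀
      qp≤ : q * p ≤ 2 * b * e
      qp≤ = linear 0 hyp (lemma b q p e)
        where
        lemma : ∀ b q p e → 2 * b * e + (4 * b + q) * p ≡ q * p + 2 * ((e + 2 * p) * b) + 0
        lemma = solve-∀
      lemma₁ : ∀ q p → q * q * (p * p) ≡ q * p * (q * p)
      lemma₁ = solve-∀
      lemma₂ : ∀ b e → 2 * b * e * (2 * b * e) ≡ 2 * (b * b) * (2 * (e * e))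
      lemma₂ = solve-∀

square : ∀ n → n ^ 2 ≡ n * n
square n = cong (n *_) (*-identityʳ n)

theorem17 : ((a b : ℕ) → 1 ≤ b → BelowCrit a b → ContainsPower u a b)
    × ((a b : ℕ) → 1 ≤ b → AboveCrit a b → ¬ ContainsPower u a b)
theorem17 = below , above
  where
  below : (a b : ℕ) → 1 ≤ b → BelowCrit a b → ContainsPower u a b
  -- The factor 202 first occurs in `hω` at position 17, which evaluation confirms.
  below a b 1≤b crit = Binary.below⇒power hω hω-image u u-image {17} refl refl refl a b q (m≤n+m∸n (2 * a) (4 * b)) (q² crit)
    where
    q = 2 * a ∸ 4 * b
    q² : BelowCrit a b → q * q < 2 * (b * b)
    q² (inj₁ a≤) rewrite m≤n⇒m∸n≡0 a≤ = *-mono-≤ {1} {2} (s≤s z≤n) (*-mono-≤ 1≤b 1≤b)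
    q² (inj₂ lt) = subst₂ _<_ (square q) (cong (2 *_) (square b)) lt
  above : (a b : ℕ) → 1 ≤ b → AboveCrit a b → ¬ ContainsPower u a b
  above a b 1≤b (lt , q²) = Binary.above⇒no-power hω hω-image u u-image a b q 1≤b
    (≤-reflexive (m+[n∸m]≡n (<⇒≤ lt))) (subst₂ _<_ (cong (2 *_) (square b)) (square q) q²)
    where q = 2 * a ∸ 4 * b
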